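{- Consider instances of Fair Max-Min diversification with $n$ points, $m$ groups, parameters $k_1,\dots,k_m$, $k=\sum_i k_i$ and optimal diversity $\ell^*$, whose points arrive one by one in a stream, where a lower bound on the minimum and an upper bound on the maximum pairwise distance are given, with ratio $\mathrm{poly}(n)$. Let $\epsilon\in(0,1)$. (1) For general metrics, there is a single-pass data stream algorithm using $O(\epsilon^{ -1}km\log n)$ space that returns a $30(1+\epsilon)$-approximation with $(1-\epsilon)$-fairness, i.e. a set $\mathcal{S}\subseteq\mathcal{X}$ with $\mathrm{div}(\mathcal{S})\ge\ell^*/(30(1+\epsilon))$ and $|\mathcal{S}\cap\mathcal{X}_i|\ge(1-\epsilon)k_i$ for all $i\in[m]$. (2) For Euclidean metrics, there is a single-pass data stream algorithm using $O((8/\epsilon)^\lambda km\,\epsilon^{ -1}\log n)$ space that returns a $(1+\epsilon)$-approximation with $(1-\epsilon)$-fairness, i.e. a set $\mathcal{S}\subseteq\mathcal{X}$ with $\mathrm{div}(\mathcal{S})\ge\ell^*/(1+\epsilon)$ and $|\mathcal{S}\cap\mathcal{X}_i|\ge(1-\epsilon)k_i$ for all $i\in[m]$, where $\lambda$ is the doubling dimension of $\mathcal{X}\subset\mathbb{R}^D$.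
   Context: Fair Max-Min diversification: the input is a metric space $(\mathcal{X},d)$ with $|\mathcal{X}|=n$, where $\mathcal{X}=\bigcup_{i=1}^m\mathcal{X}_i$ is partitioned into $m$ disjoint groups, and non-negative integers $k_1,\dots,k_m$ with $k_i\le|\mathcal{X}_i|$. For $\mathcal{S}\subseteq\mathcal{X}$ let $\mathrm{div}(\mathcal{S})=\min_{u,v\in\mathcal{S},u\ne v}d(u,v)$. The optimal diversity is $\ell^*=\max\{\mathrm{div}(\mathcal{S}):\mathcal{S}\subseteq\mathcal{X},\ |\mathcal{S}\cap\mathcal{X}_i|=k_i\ \forall i\in[m]\}$. Doubling dimension: write $\mathbf{B}(p,r)=\{q\in\mathcal{X}: d(p,q)<r\}$. The doubling dimension of $\mathcal{X}$ is the smallest integer $\lambda$ such that any ball $\mathbf{B}(p,r)$ of radius $r$ around a point $p\in\mathcal{X}$ can be covered using at most $(r/r')^\lambda$ balls of radius $r'$. Streaming: points are revealed one at a time (with their group), in one pass; space is measured in the number of stored points.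
   Formalization: The covering condition defining the doubling dimension is required only for radii with 2r' ≤ r; as literally stated (all r' < r, balls centred in X) no finite space with at least two points has a doubling dimension. -}

module Defs where

open import Algebra.Bundles using (CommutativeRing; Semiring)
open import Algebra.Core using (Op₁; Op₂)
import Algebra.Definitions.RawSemiring as RawSemiringDefs
open import Data.Fin.Base using (Fin; suc)
open import Data.Fin.Properties using (_≟_)
open import Data.Fin.Subset using (Subset; _∈_; _∩_; ∣_∣; ⁅_⁆; ⋃; ⊥)
open import Data.Fin.Subset.Properties using (_∈?_)
import Data.List.Extrema as Extrema
open import Data.List.Base as List using (List; allFin; cartesianProduct; filter; foldl; length)
open import Data.List.Relation.Unary.Any using (Any)
open import Data.Maybe.Base as Maybe using (Maybe; just; nothing; maybe′; _>>=_)
open import Data.Nat.Base as ℕ using (ℕ)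
open import Data.Product.Base using (_×_; _,_; ∃; ∃-syntax; Σ-syntax; uncurry)
open import Data.Vec.Base as Vec using (Vec; lookup; tabulate)
open import Data.Vec.Functional using (Vector; _∷_)
open import Function.Base using (_∘_)
open import Function.Metric.Structures using (IsGeneralMetric)
open import Level using (0ℓ) renaming (suc to lsuc)
open import Relation.Binary.Bundles using (TotalOrder)
open import Relation.Binary.Core using (Rel)
open import Relation.Binary.PropositionalEquality using (_≡_; _≢_)
open import Relation.Binary.Structures using (IsDecTotalOrder)
import Relation.Binary.Construct.Add.Supremum.Equality as AddSupremumEquality
import Relation.Binary.Construct.Add.Supremum.NonStrict as AddSupremum
import Relation.Binary.Construct.NonStrictToStrict as NonStrictToStrict
open import Relation.Nullary using (¬_; does)
open import Relation.Nullary.Construct.Add.Supremum using (_⁺; ⊤⁺; [_])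
open import Relation.Nullary.Decidable using (¬?; _×-dec_)

-- The standard library has no real numbers; they are axiomatised as a complete
-- ordered field, which determines them up to isomorphism.  The decidability of
-- the order and the Archimedean property hold for the classical reals, but
-- completeness does not yield them constructively, so they are listed.
record Reals : Set₁ where
  field
    commutativeRing : CommutativeRing 0ℓ 0ℓ

  open CommutativeRing commutativeRing public

  infix 4 _≤_
  infix 8 _⁻¹

  field
    _≤_             : Rel Carrier 0ℓ
    isDecTotalOrder : IsDecTotalOrder _≈_ _≤_
    +-monoʳ-≤       : ∀ z {x y} → x ≤ y → z + x ≤ z + y
    *-nonNegative   : ∀ {x y} → 0# ≤ x → 0# ≤ y → 0# ≤ x * y
    0≉1             : ¬ (0# ≈ 1#)
    _⁻¹             : Op₁ Carrier   -- 0# ⁻¹ is unspecified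
    *-inverseʳ      : ∀ {x} → ¬ (x ≈ 0#) → x * x ⁻¹ ≈ 1#

  open NonStrictToStrict _≈_ _≤_ public using (_<_)
  open RawSemiringDefs (Semiring.rawSemiring semiring) public
    using (sum; _^_) renaming (_×_ to _·_)

  ι : ℕ → Carrier
  ι n = n · 1#

  infixl 7 _/_
  _/_ : Op₂ Carrier
  x / y = x * y ⁻¹

  UpperBound : (Carrier → Set) → Carrier → Set
  UpperBound P b = ∀ x → P x → x ≤ b

  field
    archimedean : ∀ x → ∃[ n ] x ≤ ι n
    complete    : ∀ P → ∃ P → ∃ (UpperBound P) →
                  ∃[ s ] UpperBound P s × (∀ b → UpperBound P b → s ≤ b)

module Diversification (ℝ : Reals) where

  open Reals ℝ

  -- Diversities take values in ℝ ∪ {∞}: the minimum over the pairs of distinct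
  -- elements of a set with at most one element is ∞ (written ⊤⁺).
  open AddSupremum _≤_ public using (_≤⁺_; ≤⁺-isDecTotalOrder)
  open AddSupremumEquality _≈_ public using (_≈⁺_)

  ≤⁺-totalOrder : TotalOrder 0ℓ 0ℓ 0ℓ
  ≤⁺-totalOrder = record
    { isTotalOrder = IsDecTotalOrder.isTotalOrder (≤⁺-isDecTotalOrder isDecTotalOrder) }

  infixl 7 _/⁺_
  _/⁺_ : Carrier ⁺ → Carrier → Carrier ⁺
  ⊤⁺    /⁺ y = ⊤⁺
  [ x ] /⁺ y = [ x / y ]

  groupOf : ∀ {n m} → (Fin n → Fin m) → Fin m → Subset n
  groupOf label i = tabulate λ x → does (label x ≟ i)

  -- The points are named 0, …, n - 1 in their order of arrival in the stream;
  -- the metric is arbitrary, so quantifying over instances covers every order.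
  record Instance (n m : ℕ) (k : Vec ℕ m) : Set where
    field
      d        : Fin n → Fin n → Carrier
      isMetric : IsGeneralMetric _≡_ _≈_ _≤_ 0# _+_ d
      label    : Fin n → Fin m
      k≤       : ∀ i → lookup k i ℕ.≤ ∣ groupOf label i ∣

    group : Fin m → Subset n
    group = groupOf label

    distinctPairs : Subset n → List (Fin n × Fin n)
    distinctPairs S =
      filter (λ (u , v) → u ∈? S ×-dec v ∈? S ×-dec ¬? (u ≟ v))
             (cartesianProduct (allFin n) (allFin n))

    div : Subset n → Carrier ⁺
    div S = Extrema.min ≤⁺-totalOrder ⊤⁺ (List.map ([_] ∘ uncurry d) (distinctPairs S))

    Feasible : Subset n → Set
    Feasible S = ∀ i → ∣ S ∩ group i ∣ ≡ lookup k i

    IsOptimalDiversity : Carrier ⁺ → Set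
    IsOptimalDiversity ℓ =
      (∃[ S ] Feasible S × div S ≈⁺ ℓ) × (∀ S → Feasible S → div S ≤⁺ ℓ)

    DistancesWithin : Carrier → Carrier → Set
    DistancesWithin lo hi = ∀ u v → u ≢ v → lo ≤ d u v × d u v ≤ hi

    InBall : Fin n → Carrier → Fin n → Set
    InBall p r q = d p q < r

    -- "Any ball of radius r is covered by at most (r / r′) ^ dim balls of radius r′."
    -- Only scales with 2 r′ ≤ r are considered.  If r were allowed to exceed
    -- the least distance r′ by arbitrarily little, then (r / r′) ^ dim would drop
    -- below 2 although two balls are needed, so no space with at least two
    -- points would have a doubling dimension.
    Doubling : ℕ → Set
    Doubling dim = ∀ p r r′ → 0# < r′ → ι 2 * r′ ≤ r →
      ∃[ centres ] ι (length centres) ≤ (r / r′) ^ dim ×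
                   (∀ q → InBall p r q → Any (λ c → InBall c r′ q) centres)

    IsDoublingDimension : ℕ → Set
    IsDoublingDimension dim = Doubling dim × (∀ dim′ → Doubling dim′ → dim ℕ.≤ dim′)

    -- d u v is nonnegative, hence it is the Euclidean norm of φ u - φ v.
    Euclidean : Set
    Euclidean = ∃[ D ] Σ[ φ ∈ (Fin n → Vector Carrier D) ]
      (∀ u v → d u v ^ 2 ≈ sum (λ j → (φ u j - φ v j) ^ 2))

    ApproximatesFairly : Carrier → Carrier → Carrier ⁺ → Subset n → Set
    ApproximatesFairly α ε ℓ S =
      ℓ /⁺ α ≤⁺ div S ×
      (∀ i → (1# - ε) * ι (lookup k i) ≤ ι ∣ S ∩ group i ∣)

  -- What an algorithm sees of N memory cells, each empty or holding a point:
  -- the groups of the stored points and their pairwise distances.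
  record View (N m : ℕ) : Set where
    field
      labels    : Vector (Maybe (Fin m)) N
      distances : Vector (Vector (Maybe Carrier) N) N

  -- A deterministic single-pass algorithm storing at most s points; its only
  -- state is the memory.  When a point arrives, it occupies cell zero of a view
  -- whose remaining s cells are the memory, and update names for every memory
  -- cell the cell of that view whose content it receives (nothing: it becomes
  -- empty).  At the end of the stream, output selects cells of the memory.
  record StreamAlgorithm (s m : ℕ) : Set where
    field
      update : View (ℕ.suc s) m → Vector (Maybe (Fin (ℕ.suc s))) s
      output : View s m → List (Fin s)

  module _ {s n m k} (A : StreamAlgorithm s m) (I : Instance n m k) where

    open StreamAlgorithm A
    open Instance I

    Memory : Set
    Memory = Vector (Maybe (Fin n)) s

    view : ∀ {N} → Vector (Maybe (Fin n)) N → View N m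
    view cells = record
      { labels    = λ i → Maybe.map label (cells i)
      ; distances = λ i j → Maybe.zipWith d (cells i) (cells j)
      }

    step : Memory → Fin n → Memory
    step memory x = λ i → update (view cells) i >>= cells
      where
      cells : Vector (Maybe (Fin n)) (ℕ.suc s)
      cells = just x ∷ memory

    finalMemory : Memory
    finalMemory = foldl step (λ _ → nothing) (allFin n)

    result : Subset n
    result = ⋃ (List.map (maybe′ ⁅_⁆ ⊥ ∘ finalMemory) (output (view finalMemory)))

{-# OPTIONS --safe #-}

-- For every guess g in a geometric progression of ratio 1 + ε / 4 and every
-- group, keep a greedy set of points at pairwise distance at least 2 τ g, of
-- size at most k M, where every ball of radius g is covered by M balls of radius
-- τ g (M = τ = 1 in general metrics, M = ⌈(8 / ε) ^ λ⌉ and τ = ε / 8 under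
-- doubling).  Let S be an optimal set and (1 + 4 τ) g ≤ ℓ*.  If the greedy set of
-- a group is not full, the points of S in that group move by at most 2 τ g to
-- stored points, and pairwise distances stay at least g.  If it is full, then each
-- of the fewer than k other chosen points has at most M stored points of the
-- group within distance g, so a stored point at distance at least g from all of
-- them remains.  Hence the memory contains a set with exactly the group sizes of S
-- and diversity at least g, and exhaustive search over the memory finds one at
-- least as good.  This gives factors 5 (1 + ε / 4) and (1 + ε / 2) (1 + ε / 4),
-- with exact fairness.
module Submission where

open import Defs
open import Algebra.Bundles using (CommutativeRing)
import Algebra.Properties.Ring as RingProperties
import Algebra.Properties.Semiring.Exp as SemiringExp
import Algebra.Properties.Semiring.Mult as SemiringMult
import Algebra.Solver.Ring.NaturalCoefficients.Default as SemiringSolver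
open import Data.Fin.Base using (Fin; zero; suc; toℕ; fromℕ; inject₁; combine; remQuot)
open import Data.Fin.Properties using (_≟_; any?; all?; remQuot-combine; toℕ<n; toℕ-fromℕ; toℕ-inject₁) renaming (suc-injective to Fin-suc-injective)
open import Data.Fin.Subset using (Subset; inside; outside; _∈_; _∩_; ∁; ⁅_⁆; ⋃; ⊤; ⊥; ∣_∣) renaming (_-_ to _∖_)
open import Data.Fin.Subset.Properties
open import Data.List.Base as List using (List; []; _∷_; length; foldl; allFin; cartesianProduct; applyDownFrom)
import Data.List.Extrema as Extrema
import Data.List.Membership.Propositional as List
open import Data.List.Membership.Propositional.Properties using (∈-allFin; ∈-map⁺; ∈-map⁻; ∈-filter⁺; ∈-filter⁻; ∈-cartesianProduct⁺; ∈-applyDownFrom⁺)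
open import Data.List.Properties using (length-map)
import Data.List.Relation.Unary.All as All
import Data.List.Relation.Unary.All.Properties as All
open import Data.List.Relation.Unary.AllPairs using (AllPairs; _∷_)
import Data.List.Relation.Unary.AllPairs.Properties as AllPairs
open import Data.List.Relation.Unary.Any as Any using (Any; here; there)
open import Data.List.Relation.Unary.Any.Properties using (lookup-index)
open import Data.Maybe.Base as Maybe using (Maybe; just; nothing; maybe′)
import Data.Maybe.Properties as Maybe
open import Data.Maybe.Relation.Unary.Any as MaybeAny using (just)
open import Data.Nat.Base as ℕ using (ℕ; zero; suc; z≤n; s≤s; ⌈_/2⌉; ⌊_/2⌋)
import Data.Nat.Induction as ℕ
open import Data.Nat.Logarithm using (⌈log₂_⌉; ⌈log₂⌉-mono-≤; ⌈log₂⌈n/2⌉⌉≡⌈log₂n⌉∸1)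
import Data.Nat.Properties as ℕ
open import Data.Product.Base using (_×_; _,_; ∃; ∃-syntax; Σ-syntax; proj₁; proj₂; uncurry)
open import Data.Sum.Base using (_⊎_; inj₁; inj₂)
import Data.Unit.Base as Unit
open import Data.Vec.Base as Vec using (Vec; []; _∷_; lookup; here; there)
open import Data.Vec.Functional using (Vector) renaming (_∷_ to _◂_)
open import Data.Vec.Properties using (lookup∘tabulate; lookup⇒[]=; []=⇒lookup)
open import Function.Base using (_∘_; flip)
open import Function.Metric.Structures using (IsGeneralMetric)
open import Level using (0ℓ)
open import Relation.Binary.Bundles using (Poset; TotalOrder)
import Relation.Binary.Construct.Add.Supremum.NonStrict as AddSupremum
import Relation.Binary.Construct.NonStrictToStrict as NonStrictToStrict
open import Relation.Binary.Definitions using (Decidable)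
open import Relation.Binary.PropositionalEquality as ≡ using (_≡_; _≢_; refl)
import Relation.Binary.Reasoning.PartialOrder as PartialOrderReasoning
open import Relation.Binary.Structures using (IsDecTotalOrder)
open import Relation.Nullary using (¬_; Dec; does; yes; no; contradiction)
open import Relation.Nullary.Construct.Add.Supremum using (_⁺; ⊤⁺; [_])
open import Relation.Nullary.Decidable using (dec-true; ¬?; _×-dec_; _→-dec_)

-- Counting in finite subsets, and the binary logarithm.

∣p∣≡∣p∩q∣+∣p∩∁q∣ : ∀ {n} (p q : Subset n) → ∣ p ∣ ≡ ∣ p ∩ q ∣ ℕ.+ ∣ p ∩ ∁ q ∣
∣p∣≡∣p∩q∣+∣p∩∁q∣ []            []            = refl
∣p∣≡∣p∩q∣+∣p∩∁q∣ (outside ∷ p) (_       ∷ q) = ∣p∣≡∣p∩q∣+∣p∩∁q∣ p q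
∣p∣≡∣p∩q∣+∣p∩∁q∣ (inside  ∷ p) (inside  ∷ q) = ≡.cong suc (∣p∣≡∣p∩q∣+∣p∩∁q∣ p q)
∣p∣≡∣p∩q∣+∣p∩∁q∣ (inside  ∷ p) (outside ∷ q) =
  ≡.trans (≡.cong suc (∣p∣≡∣p∩q∣+∣p∩∁q∣ p q)) (≡.sym (ℕ.+-suc ∣ p ∩ q ∣ _))

-- Pigeonhole for a relation instead of a function, so that a partner may depend on the membership
-- proof. The partner of the first element is deleted from `q`; no later element can need it.
∣p∣≤∣q∣-injective : ∀ {a b} (p : Subset a) (q : Subset b) (R : Fin a → Fin b → Set) →
  (∀ {x} → x ∈ p → ∃[ y ] y ∈ q × R x y) →
  (∀ {x x′ y} → R x y → R x′ y → x ≡ x′) →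
  ∣ p ∣ ℕ.≤ ∣ q ∣
∣p∣≤∣q∣-injective []            q R total inj = z≤n
∣p∣≤∣q∣-injective (outside ∷ p) q R total inj =
  ∣p∣≤∣q∣-injective p q (R ∘ suc) (total ∘ there) (λ r r′ → Fin-suc-injective (inj r r′))
∣p∣≤∣q∣-injective (inside ∷ p) q R total inj with total here
... | y , y∈q , Ry = ℕ.≤-<-trans
  (∣p∣≤∣q∣-injective p (q ∖ y) (R ∘ suc) total′ (λ r r′ → Fin-suc-injective (inj r r′)))
  (x∈p⇒∣p-x∣<∣p∣ y∈q)
  where
  total′ : ∀ {x} → x ∈ p → ∃[ z ] z ∈ q ∖ y × R (suc x) z
  total′ x∈p with total (there x∈p)
  ... | z , z∈q , Rz = z , x∈p∧x≢y⇒x∈p-y z∈q (λ { refl → contradiction (inj Ry Rz) λ () }) , Rz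

-- Peeling off `class zero` leaves a remainder that the later classes cover. It bounds an optimal
-- set by the sum of the quotas.
∣p∣≤sum : ∀ {n m} (k : Vec ℕ m) (class : Fin m → Subset n) (p : Subset n) →
  (∀ {x} → x ∈ p → ∃[ i ] x ∈ class i) →
  (∀ i → ∣ p ∩ class i ∣ ℕ.≤ lookup k i) →
  ∣ p ∣ ℕ.≤ Vec.sum k
∣p∣≤sum [] class p cover bound =
  ∣p∣≤∣q∣-injective p [] (λ _ ()) (λ x∈p → contradiction (proj₁ (cover x∈p)) λ ()) λ { {y = ()} }
∣p∣≤sum (k₀ ∷ k) class p cover bound = begin
  ∣ p ∣                                         ≡⟨ ∣p∣≡∣p∩q∣+∣p∩∁q∣ p (class zero) ⟩
  ∣ p ∩ class zero ∣ ℕ.+ ∣ p ∩ ∁ (class zero) ∣ ≤⟨ ℕ.+-mono-≤ (bound zero) rest ⟩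
  k₀ ℕ.+ Vec.sum k                              ∎
  where
  open ℕ.≤-Reasoning
  p′ = p ∩ ∁ (class zero)
  cover′ : ∀ {x} → x ∈ p′ → ∃[ i ] x ∈ class (suc i)
  cover′ x∈p′ with x∈p∩q⁻ p (∁ (class zero)) x∈p′
  ... | x∈p , x∈∁ with cover x∈p
  ... | zero  , x∈0 = contradiction x∈0 (x∈∁p⇒x∉p x∈∁)
  ... | suc i , x∈i = i , x∈i
  rest : ∣ p′ ∣ ℕ.≤ Vec.sum k
  rest = ∣p∣≤sum k (class ∘ suc) p′ cover′ λ i → ℕ.≤-trans
    (p⊆q⇒∣p∣≤∣q∣ λ x∈ → let x∈p′ , x∈i = x∈p∩q⁻ p′ (class (suc i)) x∈ in
                         x∈p∩q⁺ (proj₁ (x∈p∩q⁻ p _ x∈p′) , x∈i))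
    (bound (suc i))

elements : ∀ {n} → Subset n → List (Fin n)
elements []            = []
elements (inside  ∷ p) = zero ∷ List.map suc (elements p)
elements (outside ∷ p) = List.map suc (elements p)

length-elements : ∀ {n} (p : Subset n) → length (elements p) ≡ ∣ p ∣
length-elements []            = refl
length-elements (inside  ∷ p) = ≡.cong suc (≡.trans (length-map suc (elements p)) (length-elements p))
length-elements (outside ∷ p) = ≡.trans (length-map suc (elements p)) (length-elements p)

∈-elements⁺ : ∀ {n x} {p : Subset n} → x ∈ p → x List.∈ elements p
∈-elements⁺ {p = inside  ∷ p} here        = here refl
∈-elements⁺ {p = inside  ∷ p} (there x∈p) = there (∈-map⁺ suc (∈-elements⁺ x∈p))
∈-elements⁺ {p = outside ∷ p} (there x∈p) = ∈-map⁺ suc (∈-elements⁺ x∈p)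

∈-elements⁻ : ∀ {n x} {p : Subset n} → x List.∈ elements p → x ∈ p
∈-elements⁻ {p = inside  ∷ p} (here refl) = here
∈-elements⁻ {p = inside  ∷ p} (there x∈) with ∈-map⁻ suc x∈
... | _ , y∈ , refl = there (∈-elements⁻ y∈)
∈-elements⁻ {p = outside ∷ p} x∈ with ∈-map⁻ suc x∈
... | _ , y∈ , refl = there (∈-elements⁻ y∈)

∈-⋃⁺ : ∀ {n x} {p : Subset n} {ps} → p List.∈ ps → x ∈ p → x ∈ ⋃ ps
∈-⋃⁺ {ps = p ∷ ps} (here refl) x∈p = x∈p∪q⁺ (inj₁ x∈p)
∈-⋃⁺ {ps = p ∷ ps} (there p∈)  x∈p = x∈p∪q⁺ (inj₂ (∈-⋃⁺ p∈ x∈p))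

∈-⋃⁻ : ∀ {n x} (ps : List (Subset n)) → x ∈ ⋃ ps → ∃[ p ] p List.∈ ps × x ∈ p
∈-⋃⁻ []       x∈ = contradiction x∈ ∉⊥
∈-⋃⁻ (p ∷ ps) x∈ with x∈p∪q⁻ p (⋃ ps) x∈
... | inj₁ x∈p  = p , here refl , x∈p
... | inj₂ x∈ps = let q , q∈ , x∈q = ∈-⋃⁻ ps x∈ps in q , there q∈ , x∈q

module _ {n p} {P : Fin n → Set p} (P? : ∀ x → Dec (P x)) where

  comprehension : Subset n
  comprehension = Vec.tabulate λ x → does (P? x)

  ∈-comprehension⁺ : ∀ {x} → P x → x ∈ comprehension
  ∈-comprehension⁺ {x} px = lookup⇒[]= x _ (≡.trans (lookup∘tabulate _ x) (dec-true (P? x) px))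

  ∈-comprehension⁻ : ∀ {x} → x ∈ comprehension → P x
  ∈-comprehension⁻ {x} x∈ with P? x | ≡.trans (≡.sym (lookup∘tabulate (λ z → does (P? z)) x)) ([]=⇒lookup x∈)
  ... | yes px | _ = px

-- Strong induction by halving: `n` is at most twice `⌈ n /2⌉`, whose rounded logarithm is one
-- smaller. For `n ≥ 2` the logarithm is positive, so the truncated predecessor loses nothing.
n≤2^⌈log₂n⌉ : ∀ n → n ℕ.≤ 2 ℕ.^ ⌈log₂ n ⌉
n≤2^⌈log₂n⌉ = ℕ.<-rec _ go
  where
  go : ∀ n → (∀ {m} → m ℕ.< n → m ℕ.≤ 2 ℕ.^ ⌈log₂ m ⌉) → n ℕ.≤ 2 ℕ.^ ⌈log₂ n ⌉
  go 0 rec = z≤n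
  go 1 rec = ℕ.m^n>0 2 ⌈log₂ 1 ⌉
  go n@(suc (suc n-2)) rec = begin
    n                               ≡⟨ ℕ.⌊n/2⌋+⌈n/2⌉≡n n ⟨
    ⌊ n /2⌋ ℕ.+ ⌈ n /2⌉             ≤⟨ ℕ.+-monoˡ-≤ ⌈ n /2⌉ (ℕ.⌊n/2⌋≤⌈n/2⌉ n) ⟩
    ⌈ n /2⌉ ℕ.+ ⌈ n /2⌉             ≡⟨ ≡.cong (⌈ n /2⌉ ℕ.+_) (ℕ.+-identityʳ ⌈ n /2⌉) ⟨
    2 ℕ.* ⌈ n /2⌉                   ≤⟨ ℕ.*-monoʳ-≤ 2 (rec (ℕ.⌈n/2⌉<n n-2)) ⟩
    2 ℕ.* 2 ℕ.^ ⌈log₂ ⌈ n /2⌉ ⌉     ≡⟨ ≡.cong (λ l → 2 ℕ.* 2 ℕ.^ l) (⌈log₂⌈n/2⌉⌉≡⌈log₂n⌉∸1 n) ⟩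
    2 ℕ.^ suc (ℕ.pred ⌈log₂ n ⌉)    ≡⟨ ≡.cong (2 ℕ.^_) (ℕ.suc-pred ⌈log₂ n ⌉ {{ℕ.>-nonZero 1≤⌈log₂n⌉}}) ⟩
    2 ℕ.^ ⌈log₂ n ⌉                 ∎
    where
    open ℕ.≤-Reasoning
    1≤⌈log₂n⌉ : 1 ℕ.≤ ⌈log₂ n ⌉
    1≤⌈log₂n⌉ = ⌈log₂⌉-mono-≤ {2} {n} (s≤s (s≤s z≤n))

-- Arithmetic of the ordered field.

module RealProperties (ℝ : Reals) where

  open Reals ℝ hiding (zero) renaming (refl to ≈-refl)
  open RingProperties (CommutativeRing.ring commutativeRing) using (-1*x≈-x; -‿involutive)
  open SemiringMult semiring using (×1-homo-*)
  open SemiringSolver commutativeSemiring using (solve; _:=_; _:+_; _:*_; con; Polynomial) public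

  open IsDecTotalOrder isDecTotalOrder public
    using (_≤?_; isPartialOrder; antisym; total)
    renaming (_≟_ to _≈?_; refl to ≤-refl; trans to ≤-trans; reflexive to ≤-reflexive; ≤-respˡ-≈ to ≤-respˡ; ≤-respʳ-≈ to ≤-respʳ)

  ≤-poset : Poset 0ℓ 0ℓ 0ℓ
  ≤-poset = record { isPartialOrder = isPartialOrder }

  open PartialOrderReasoning ≤-poset public

  _<?_ : Decidable _<_
  _<?_ = NonStrictToStrict.<-decidable _≈_ _≤_ _≈?_ _≤?_

  ≰⇒≥ : ∀ {x y} → ¬ (x ≤ y) → y ≤ x
  ≰⇒≥ {x} {y} x≰y with total x y
  ... | inj₁ x≤y = contradiction x≤y x≰y
  ... | inj₂ y≤x = y≤x

  <⇒≱ : ∀ {x y} → x < y → ¬ (y ≤ x)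
  <⇒≱ = NonStrictToStrict.<⇒≱ _≈_ _≤_ antisym

  ≮⇒≥ : ∀ {x y} → ¬ (x < y) → y ≤ x
  ≮⇒≥ = NonStrictToStrict.≮⇒≥ _≈_ _≤_ sym _≈?_ ≤-reflexive total

  +-monoˡ-≤ : ∀ z {x y} → x ≤ y → x + z ≤ y + z
  +-monoˡ-≤ z {x} {y} x≤y = begin
    x + z ≈⟨ +-comm x z ⟩
    z + x ≤⟨ +-monoʳ-≤ z x≤y ⟩
    z + y ≈⟨ +-comm z y ⟩
    y + z ∎

  +-mono-≤ : ∀ {x y u v} → x ≤ y → u ≤ v → x + u ≤ y + v
  +-mono-≤ {x} {y} {u} {v} x≤y u≤v = ≤-trans (+-monoˡ-≤ u x≤y) (+-monoʳ-≤ y u≤v)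

  +-cancelʳ-≤ : ∀ z {x y} → x + z ≤ y + z → x ≤ y
  +-cancelʳ-≤ z {x} {y} x+z≤y+z = begin
    x         ≈⟨ cancel x ⟨
    x + z - z ≤⟨ +-monoˡ-≤ (- z) x+z≤y+z ⟩
    y + z - z ≈⟨ cancel y ⟩
    y         ∎
    where
    cancel : ∀ a → a + z - z ≈ a
    cancel a = trans (+-assoc a z (- z)) (trans (+-congˡ (-‿inverseʳ z)) (+-identityʳ a))

  x≤x+y : ∀ x {y} → 0# ≤ y → x ≤ x + y
  x≤x+y x 0≤y = ≤-respˡ (+-identityʳ x) (+-monoʳ-≤ x 0≤y)

  +-nonNegative : ∀ {x y} → 0# ≤ x → 0# ≤ y → 0# ≤ x + y
  +-nonNegative 0≤x 0≤y = ≤-trans 0≤x (x≤x+y _ 0≤y)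

  *-monoʳ-≤ : ∀ {z x y} → 0# ≤ z → x ≤ y → z * x ≤ z * y
  *-monoʳ-≤ {z} {x} {y} 0≤z x≤y = begin
    z * x                 ≤⟨ x≤x+y (z * x) (*-nonNegative 0≤z 0≤y-x) ⟩
    z * x + z * (- x + y) ≈⟨ distribˡ z x (- x + y) ⟨
    z * (x + (- x + y))   ≈⟨ *-congˡ (+-assoc x (- x) y) ⟨
    z * (x + - x + y)     ≈⟨ *-congˡ (+-congʳ (-‿inverseʳ x)) ⟩
    z * (0# + y)          ≈⟨ *-congˡ (+-identityˡ y) ⟩
    z * y                 ∎
    where
    0≤y-x : 0# ≤ - x + y
    0≤y-x = ≤-respˡ (-‿inverseˡ x) (+-monoʳ-≤ (- x) x≤y)

  *-monoˡ-≤ : ∀ {z x y} → 0# ≤ z → x ≤ y → x * z ≤ y * z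
  *-monoˡ-≤ {z} {x} {y} 0≤z x≤y = begin
    x * z ≈⟨ *-comm x z ⟩
    z * x ≤⟨ *-monoʳ-≤ 0≤z x≤y ⟩
    z * y ≈⟨ *-comm z y ⟩
    y * z ∎

  *-mono-≤ : ∀ {x y u v} → 0# ≤ y → 0# ≤ u → x ≤ y → u ≤ v → x * u ≤ y * v
  *-mono-≤ 0≤y 0≤u x≤y u≤v = ≤-trans (*-monoˡ-≤ 0≤u x≤y) (*-monoʳ-≤ 0≤y u≤v)

  -- Otherwise `- 1#` would be nonnegative, and so would its square, which is `1#`.
  0≤1 : 0# ≤ 1#
  0≤1 with total 0# 1#
  ... | inj₁ 0≤1 = 0≤1
  ... | inj₂ 1≤0 = ≤-respʳ (trans (-1*x≈-x (- 1#)) (-‿involutive 1#)) (*-nonNegative 0≤-1 0≤-1)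
    where
    0≤-1 : 0# ≤ - 1#
    0≤-1 = begin
      0#         ≈⟨ -‿inverseˡ 1# ⟨
      - 1# + 1#  ≤⟨ +-monoʳ-≤ (- 1#) 1≤0 ⟩
      - 1# + 0#  ≈⟨ +-identityʳ (- 1#) ⟩
      - 1#       ∎

  0<1 : 0# < 1#
  0<1 = 0≤1 , 0≉1

  1≤⇒0< : ∀ {x} → 1# ≤ x → 0# < x
  1≤⇒0< {x} 1≤x = ≤-trans 0≤1 1≤x , λ 0≈x → 0≉1 (antisym 0≤1 (≤-respʳ (sym 0≈x) 1≤x))

  x*x⁻¹≈1 : ∀ {x} → 0# < x → x * x ⁻¹ ≈ 1#
  x*x⁻¹≈1 (_ , 0≉x) = *-inverseʳ (0≉x ∘ sym)

  0≤x⁻¹ : ∀ {x} → 0# < x → 0# ≤ x ⁻¹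
  0≤x⁻¹ {x} 0<x with total 0# (x ⁻¹)
  ... | inj₁ 0≤x⁻¹ = 0≤x⁻¹
  ... | inj₂ x⁻¹≤0 = contradiction 1≤0 (<⇒≱ 0<1)
    where
    1≤0 : 1# ≤ 0#
    1≤0 = begin
      1#       ≈⟨ x*x⁻¹≈1 0<x ⟨
      x * x ⁻¹ ≤⟨ *-monoʳ-≤ (proj₁ 0<x) x⁻¹≤0 ⟩
      x * 0#   ≈⟨ zeroʳ x ⟩
      0#       ∎

  xz/z≈x : ∀ x {z} → 0# < z → x * z / z ≈ x
  xz/z≈x x {z} 0<z = trans (*-assoc x z (z ⁻¹)) (trans (*-congˡ (x*x⁻¹≈1 0<z)) (*-identityʳ x))

  x/z*z≈x : ∀ x {z} → 0# < z → x / z * z ≈ x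
  x/z*z≈x x {z} 0<z = begin-equality
    x * z ⁻¹ * z ≈⟨ solve 3 (λ a b c → a :* b :* c := a :* c :* b) ≈-refl x (z ⁻¹) z ⟩
    x * z / z    ≈⟨ xz/z≈x x 0<z ⟩
    x            ∎

  x≤y*z⇒x/z≤y : ∀ {x y z} → 0# < z → x ≤ y * z → x / z ≤ y
  x≤y*z⇒x/z≤y {x} {y} {z} 0<z x≤yz = ≤-respʳ (xz/z≈x y 0<z) (*-monoˡ-≤ (0≤x⁻¹ 0<z) x≤yz)

  x*z≤y⇒x≤y/z : ∀ {x y z} → 0# < z → x * z ≤ y → x ≤ y / z
  x*z≤y⇒x≤y/z {x} {y} {z} 0<z xz≤y = ≤-respˡ (xz/z≈x x 0<z) (*-monoˡ-≤ (0≤x⁻¹ 0<z) xz≤y)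

  x/z≤y⇒x≤y*z : ∀ {x y z} → 0# < z → x / z ≤ y → x ≤ y * z
  x/z≤y⇒x≤y*z {x} {y} {z} 0<z x/z≤y = ≤-respˡ (x/z*z≈x x 0<z) (*-monoˡ-≤ (proj₁ 0<z) x/z≤y)

  *-positive : ∀ {x y} → 0# < x → 0# < y → 0# < x * y
  *-positive {x} {y} 0<x 0<y = *-nonNegative (proj₁ 0<x) (proj₁ 0<y) , λ 0≈xy →
    proj₂ 0<x (begin-equality
      0#        ≈⟨ zeroˡ (y ⁻¹) ⟨
      0# / y    ≈⟨ *-congʳ 0≈xy ⟩
      x * y / y ≈⟨ xz/z≈x x 0<y ⟩
      x         ∎)

  0<x⁻¹ : ∀ {x} → 0# < x → 0# < x ⁻¹
  0<x⁻¹ {x} 0<x = 0≤x⁻¹ 0<x , λ 0≈x⁻¹ →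
    0≉1 (trans (sym (zeroʳ x)) (trans (*-congˡ 0≈x⁻¹) (x*x⁻¹≈1 0<x)))

  -- Polynomials of the solver that evaluate to ι n by definition.
  num : ∀ {v} → ℕ → Polynomial v
  num zero    = con 0
  num (suc n) = con 1 :+ num n

  ι-* : ∀ m n → ι (m ℕ.* n) ≈ ι m * ι n
  ι-* = ×1-homo-*

  0≤ι : ∀ n → 0# ≤ ι n
  0≤ι zero    = ≤-refl
  0≤ι (suc n) = +-nonNegative 0≤1 (0≤ι n)

  1≤ι : ∀ n → 1# ≤ ι (suc n)
  1≤ι n = x≤x+y 1# (0≤ι n)

  0<ι : ∀ n → 0# < ι (suc n)
  0<ι n = 1≤⇒0< (1≤ι n)

  ι-mono-≤ : ∀ {m n} → m ℕ.≤ n → ι m ≤ ι n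
  ι-mono-≤ {n = n} z≤n = 0≤ι n
  ι-mono-≤ (s≤s m≤n) = +-monoʳ-≤ 1# (ι-mono-≤ m≤n)

  -- Brings bounds on real counts back to natural numbers: `n < m` would give `1 + ι n ≤ ι n`.
  ι-cancel-≤ : ∀ {m n} → ι m ≤ ι n → m ℕ.≤ n
  ι-cancel-≤ {m} {n} ιm≤ιn = ℕ.≮⇒≥ λ n<m → <⇒≱ 0<1
    (+-cancelʳ-≤ (ι n) (≤-respʳ (sym (+-identityˡ (ι n))) (≤-trans (ι-mono-≤ n<m) ιm≤ιn)))

  0≤^ : ∀ {x} → 0# ≤ x → ∀ n → 0# ≤ x ^ n
  0≤^ 0≤x zero    = 0≤1
  0≤^ 0≤x (suc n) = *-nonNegative 0≤x (0≤^ 0≤x n)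

  1≤^ : ∀ {x} → 1# ≤ x → ∀ n → 1# ≤ x ^ n
  1≤^ 1≤x zero    = ≤-refl
  1≤^ {x} 1≤x (suc n) = ≤-respˡ (*-identityˡ 1#)
    (*-mono-≤ (≤-trans 0≤1 1≤x) 0≤1 1≤x (1≤^ 1≤x n))

  ^-monoˡ-≤ : ∀ {x y} → 0# ≤ x → x ≤ y → ∀ n → x ^ n ≤ y ^ n
  ^-monoˡ-≤ 0≤x x≤y zero    = ≤-refl
  ^-monoˡ-≤ 0≤x x≤y (suc n) =
    *-mono-≤ (≤-trans 0≤x x≤y) (0≤^ 0≤x n) x≤y (^-monoˡ-≤ 0≤x x≤y n)

  ι^≤^ : ∀ b {x} → ι b ≤ x → ∀ n → ι (b ℕ.^ n) ≤ x ^ n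
  ι^≤^ b ιb≤x zero    = ≤-reflexive (+-identityʳ 1#)
  ι^≤^ b {x} ιb≤x (suc n) = ≤-respˡ (sym (ι-* b (b ℕ.^ n)))
    (*-mono-≤ (≤-trans (0≤ι b) ιb≤x) (0≤ι (b ℕ.^ n)) ιb≤x (ι^≤^ b ιb≤x n))

  bernoulli : ∀ {x} → 0# ≤ x → ∀ n → 1# + ι n * x ≤ (1# + x) ^ n
  bernoulli {x} 0≤x zero = ≤-reflexive (trans (+-congˡ (zeroˡ x)) (+-identityʳ 1#))
  bernoulli {x} 0≤x (suc n) = begin
    1# + ι (suc n) * x
      -- The term `n x²` is what the product below has in excess of the linear bound.
      ≤⟨ x≤x+y _ (*-nonNegative (*-nonNegative (0≤ι n) 0≤x) 0≤x) ⟩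
    1# + ι (suc n) * x + ι n * x * x
      ≈⟨ solve 2 (λ a y → con 1 :+ (con 1 :+ a) :* y :+ a :* y :* y
                        := (con 1 :+ y) :* (con 1 :+ a :* y)) ≈-refl (ι n) x ⟩
    (1# + x) * (1# + ι n * x)
      ≤⟨ *-monoʳ-≤ (+-nonNegative 0≤1 0≤x) (bernoulli 0≤x n) ⟩
    (1# + x) * (1# + x) ^ n ∎

  -- Rounding up at most doubles a number that is at least one. The search descends from an
  -- Archimedean bound until the next lower integer is at most `x`.
  ceiling : ∀ {x} → 1# ≤ x → ∃[ n ] x ≤ ι n × ι n ≤ ι 2 * x
  ceiling {x} 1≤x = let n , x≤ιn = archimedean x in go n x≤ιn
    where
    go : ∀ n → x ≤ ι n → ∃[ n ] x ≤ ι n × ι n ≤ ι 2 * x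
    go zero    x≤0 = contradiction (≤-trans 1≤x x≤0) (<⇒≱ 0<1)
    go (suc n) x≤ι with x ≤? ι n
    ... | yes x≤ιn = go n x≤ιn
    ... | no  x≰ιn = suc n , x≤ι , (begin
      1# + ι n ≤⟨ +-mono-≤ 1≤x (≰⇒≥ x≰ιn) ⟩
      x + x    ≈⟨ solve 1 (λ y → y :+ y := num 2 :* y) ≈-refl x ⟩
      ι 2 * x  ∎)

-- Packing in balls and the choice of far-apart stored points.

module Selection (ℝ : Reals) {n m : ℕ} {k : Vec ℕ m} (I : Diversification.Instance ℝ n m k) where

  open Reals ℝ hiding (zero) renaming (refl to ≈-refl)
  open Diversification ℝ
  open RealProperties ℝ
  open Instance I
  open IsGeneralMetric isMetric using (triangle; ≈⇒0) renaming (sym to d-sym)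

  -- A covering property for one pair of radii with an integer bound, the common form of the trivial
  -- cover by the ball itself and of the doubling property.
  Covers : ℕ → Carrier → Carrier → Set
  Covers M R r = ∀ p → ∃[ centres ] length centres ℕ.≤ M ×
    (∀ q → InBall p R q → Any (λ c → InBall c r q) centres)

  Separated : Carrier → Subset n → Set
  Separated δ G = ∀ {x y} → x ∈ G → y ∈ G → x ≢ y → δ ≤ d x y

  InBall-diameter : ∀ {c r x y} → InBall c r x → InBall c r y → ¬ (r + r ≤ d x y)
  InBall-diameter {c} {r} {x} {y} cx cy 2r≤xy = <⇒≱ cx (+-cancelʳ-≤ r (begin
    r + r           ≤⟨ 2r≤xy ⟩
    d x y           ≤⟨ triangle x c y ⟩
    d x c + d c y   ≈⟨ +-congʳ (d-sym x c) ⟩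
    d c x + d c y   ≤⟨ +-monoʳ-≤ (d c x) (proj₁ cy) ⟩
    d c x + r       ∎))

  ball : Fin n → Carrier → Subset n
  ball p R = comprehension (λ q → d p q <? R)

  -- Each point is sent to a covering centre within `r`. Two points at the same centre are closer
  -- than `r + r`, hence equal.
  packing : ∀ {M R r G} → Covers M R r → Separated (r + r) G → ∀ p → ∣ G ∩ ball p R ∣ ℕ.≤ M
  packing {M} {R} {r} {G} covers separated p with covers p
  ... | centres , ∣centres∣≤M , covered = ℕ.≤-trans (≡.subst (∣ G ∩ ball p R ∣ ℕ.≤_)
      (∣⊤∣≡n _) (∣p∣≤∣q∣-injective (G ∩ ball p R) ⊤ Near total′ injective)) ∣centres∣≤M
    where
    Near : Fin n → Fin (length centres) → Set
    Near q i = q ∈ G × InBall (List.lookup centres i) r q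
    total′ : ∀ {q} → q ∈ G ∩ ball p R → ∃[ i ] i ∈ ⊤ × Near q i
    total′ {q} q∈ =
      let q∈G , q∈B = x∈p∩q⁻ G (ball p R) q∈
          near      = covered q (∈-comprehension⁻ (λ q → d p q <? R) q∈B)
      in Any.index near , ∈⊤ , q∈G , lookup-index near
    injective : ∀ {x y i} → Near x i → Near y i → x ≡ y
    injective {x} {y} (x∈G , cx) (y∈G , cy) with x ≟ y
    ... | yes x≡y = x≡y
    ... | no  x≢y = contradiction (separated x∈G y∈G x≢y) (InBall-diameter cx cy)

  -- Each `u` rules out at most `M` points of `G`, so all of `us` together rule out fewer than
  -- `∣ G ∣`. The induction discards one ball at a time.
  avoid : ∀ {M R} us G → (∀ u → ∣ G ∩ ball u R ∣ ℕ.≤ M) → length us ℕ.* M ℕ.< ∣ G ∣ →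
          ∃[ y ] y ∈ G × (∀ {u} → u List.∈ us → R ≤ d u y)
  avoid [] G small 0<∣G∣ with nonempty? G
  ... | yes (y , y∈G) = y , y∈G , λ ()
  ... | no  empty     = contradiction 0<∣G∣ (ℕ.≤⇒≯ (ℕ.≤-reflexive
    (≡.trans (≡.cong ∣_∣ (Empty-unique empty)) (∣⊥∣≡0 n))))
  avoid {M} {R} (u ∷ us) G small M+l*M<∣G∣
    with avoid us (G ∩ ∁ (ball u R)) small′ l*M<
    where
    small′ : ∀ v → ∣ (G ∩ ∁ (ball u R)) ∩ ball v R ∣ ℕ.≤ M
    small′ v = ℕ.≤-trans (p⊆q⇒∣p∣≤∣q∣ λ x∈ →
      let x∈G′ , x∈B = x∈p∩q⁻ _ (ball v R) x∈
      in x∈p∩q⁺ (proj₁ (x∈p∩q⁻ G _ x∈G′) , x∈B)) (small v)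
    l*M< : length us ℕ.* M ℕ.< ∣ G ∩ ∁ (ball u R) ∣
    l*M< = ℕ.+-cancelˡ-< M _ _ (ℕ.<-≤-trans M+l*M<∣G∣ (ℕ.≤-trans
      (ℕ.≤-reflexive (∣p∣≡∣p∩q∣+∣p∩∁q∣ G (ball u R))) (ℕ.+-monoˡ-≤ _ (small u))))
  ... | y , y∈ , far = y , proj₁ (x∈p∩q⁻ G _ y∈) , λ where
    (here refl)  → ≮⇒≥ λ uy → x∈∁p⇒x∉p (proj₂ (x∈p∩q⁻ G _ y∈))
                                 (∈-comprehension⁺ (λ q → d u q <? R) uy)
    (there v∈us) → far v∈us

  module _ {M R r} (S : Subset n) (G : Fin m → Subset n)
    (1≤M       : 1 ℕ.≤ M)
    (covers    : Covers M R r)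
    (separated : ∀ i → Separated (r + r) (G i))
    (near      : ∀ x → ¬ (∣ S ∣ ℕ.* M ℕ.≤ ∣ G (label x) ∣) →
                 ∃[ y ] y ∈ G (label x) × d x y ≤ r + r)
    (spread    : Separated (R + ((r + r) + (r + r))) S)
    where

    Full : Fin m → Set
    Full i = ∣ S ∣ ℕ.* M ℕ.≤ ∣ G i ∣

    -- The invariant of the greedy choice: points of groups that are not full move
    -- to a neighbour right away, points of full groups are placed one by one.
    Settled : List (Fin n) → Fin n → Set
    Settled zs x = ¬ Full (label x) ⊎ x List.∈ zs

    Selects : List (Fin n) → (Fin n → Fin n) → Set
    Selects zs f =
      (∀ {x} → x ∈ S → Settled zs x → f x ∈ G (label x)) ×
      (∀ {x y} → x ∈ S → y ∈ S → x ≢ y → Settled zs x → Settled zs y → R ≤ d (f x) (f y))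

    -- Two moves of length at most `2 r` shorten a distance by at most `4 r`, the surplus provided
    -- by `spread`.
    moved : ∀ {x x′ y y′} → R + ((r + r) + (r + r)) ≤ d x y →
            d x x′ ≤ r + r → d y y′ ≤ r + r → R ≤ d x′ y′
    moved {x} {x′} {y} {y′} far xx′ yy′ = +-cancelʳ-≤ ((r + r) + (r + r)) (begin
      R + ((r + r) + (r + r))       ≤⟨ far ⟩
      d x y                         ≤⟨ triangle x x′ y ⟩
      d x x′ + d x′ y               ≤⟨ +-mono-≤ xx′ (triangle x′ y′ y) ⟩
      (r + r) + (d x′ y′ + d y′ y)  ≤⟨ +-monoʳ-≤ _ (+-monoʳ-≤ _ (≤-respˡ (d-sym y y′) yy′)) ⟩
      (r + r) + (d x′ y′ + (r + r)) ≈⟨ solve 2 (λ a b → a :+ (b :+ a) := b :+ (a :+ a)) ≈-refl (r + r) (d x′ y′) ⟩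
      d x′ y′ + ((r + r) + (r + r)) ∎)

    select : ∀ zs → ∃ (Selects zs)
    select [] = f , (λ {x} _ s → proj₁ (f-near s)) ,
      λ x∈S y∈S x≢y sx sy → moved (spread x∈S y∈S x≢y) (proj₂ (f-near sx)) (proj₂ (f-near sy))
      where
      f : Fin n → Fin n
      f x with (∣ S ∣ ℕ.* M) ℕ.≤? ∣ G (label x) ∣
      -- A default value: a point of a full group is not settled by the empty list, so nothing is
      -- claimed about its image yet.
      ... | yes _    = x
      ... | no ¬full = proj₁ (near x ¬full)
      f-near : ∀ {x} → Settled [] x → f x ∈ G (label x) × d x (f x) ≤ r + r
      f-near {x} (inj₁ ¬full) with (∣ S ∣ ℕ.* M) ℕ.≤? ∣ G (label x) ∣
      ... | yes full = contradiction full ¬full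
      ... | no ¬full = proj₂ (near x ¬full)
    -- The place of z avoids the images of all other points of S, including those
    -- not yet settled, whose images are arbitrary: only their number matters.
    select (z ∷ zs) with select zs | z ∈? S | (∣ S ∣ ℕ.* M) ℕ.≤? ∣ G (label z) ∣
    ... | f , f∈G , f-far | no z∉S | _ = f , (λ x∈S → f∈G x∈S ∘ earlier x∈S) ,
      λ x∈S y∈S x≢y sx sy → f-far x∈S y∈S x≢y (earlier x∈S sx) (earlier y∈S sy)
      where
      earlier : ∀ {x} → x ∈ S → Settled (z ∷ zs) x → Settled zs x
      earlier x∈S (inj₁ ¬full)        = inj₁ ¬full
      earlier x∈S (inj₂ (here refl))  = contradiction x∈S z∉S
      earlier x∈S (inj₂ (there x∈zs)) = inj₂ x∈zs
    ... | f , f∈G , f-far | yes _ | no ¬full = f , (λ x∈S → f∈G x∈S ∘ earlier) ,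
      λ x∈S y∈S x≢y sx sy → f-far x∈S y∈S x≢y (earlier sx) (earlier sy)
      where
      earlier : ∀ {x} → Settled (z ∷ zs) x → Settled zs x
      earlier (inj₁ ¬full)        = inj₁ ¬full
      earlier (inj₂ (here refl))  = inj₁ ¬full
      earlier (inj₂ (there x∈zs)) = inj₂ x∈zs
    ... | f , f∈G , f-far | yes z∈S | yes full
      with avoid (List.map f (elements (S ∖ z))) (G (label z))
             (packing covers (separated (label z))) room
      where
      room : length (List.map f (elements (S ∖ z))) ℕ.* M ℕ.< ∣ G (label z) ∣
      -- Leaving out `z` makes the number of balls to avoid strictly smaller than `∣ S ∣`; `1 ≤ M`
      -- keeps the inequality strict after multiplication.
      room = ℕ.<-≤-trans (ℕ.*-monoˡ-< M {{ℕ.>-nonZero 1≤M}} (≡.subst (ℕ._< ∣ S ∣)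
        (≡.sym (≡.trans (length-map f (elements (S ∖ z))) (length-elements (S ∖ z))))
        (x∈p⇒∣p-x∣<∣p∣ z∈S))) full
    ... | y , y∈G , y-far = g , g∈G , g-far
      where
      g : Fin n → Fin n
      g x with x ≟ z
      ... | yes _ = y
      ... | no  _ = f x
      earlier : ∀ {x} → x ≢ z → Settled (z ∷ zs) x → Settled zs x
      earlier x≢z (inj₁ ¬full)        = inj₁ ¬full
      earlier x≢z (inj₂ (here x≡z))   = contradiction x≡z x≢z
      earlier x≢z (inj₂ (there x∈zs)) = inj₂ x∈zs
      y-far′ : ∀ {x} → x ∈ S → x ≢ z → R ≤ d (f x) y
      y-far′ x∈S x≢z = y-far (∈-map⁺ f (∈-elements⁺ (x∈p∧x≢y⇒x∈p-y x∈S x≢z)))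
      g∈G : ∀ {x} → x ∈ S → Settled (z ∷ zs) x → g x ∈ G (label x)
      g∈G {x} x∈S sx with x ≟ z
      ... | yes refl = y∈G
      ... | no  x≢z  = f∈G x∈S (earlier x≢z sx)
      g-far : ∀ {x y} → x ∈ S → y ∈ S → x ≢ y → Settled (z ∷ zs) x → Settled (z ∷ zs) y →
              R ≤ d (g x) (g y)
      g-far {u} {v} u∈S v∈S u≢v su sv with u ≟ z | v ≟ z
      ... | yes refl | yes refl = contradiction refl u≢v
      ... | yes refl | no  v≢z  = ≤-respʳ (d-sym _ _) (y-far′ v∈S v≢z)
      ... | no  u≢z  | yes refl = y-far′ u∈S u≢z
      ... | no  u≢z  | no  v≢z  = f-far u∈S v∈S u≢v (earlier u≢z su) (earlier v≢z sv)

    -- Once the list contains all points, every point is settled.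
    selection : ∃[ f ] (∀ {x} → x ∈ S → f x ∈ G (label x)) ×
                       (∀ {x y} → x ∈ S → y ∈ S → x ≢ y → R ≤ d (f x) (f y))
    selection with select (allFin n)
    ... | f , f∈G , f-far = f , (λ x∈S → f∈G x∈S (inj₂ (∈-allFin _))) ,
      λ x∈S y∈S x≢y → f-far x∈S y∈S x≢y (inj₂ (∈-allFin _)) (inj₂ (∈-allFin _))

-- The greedy streaming update and its invariants.

module RowAlgorithm (ℝ : Reals) {rows m : ℕ} (T : ℕ)
  (scale : Fin rows → Reals.Carrier ℝ) (colour : Fin rows → Fin m) where

  open Reals ℝ hiding (zero) renaming (refl to ≈-refl)
  open Diversification ℝ
  open RealProperties ℝ

  s : ℕ
  s = rows ℕ.* T

  -- The arriving point is cell zero of the view, so memory cells are shifted by `suc`. The last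
  -- component of a proof names the free cell that will receive the point.
  Writable : View (suc s) m → Fin rows → Set
  Writable v r =
    (View.labels v zero ≡ just (colour r) ×
     ¬ ∃ λ t → MaybeAny.Any (_< scale r) (View.distances v zero (suc (combine r t)))) ×
    ∃[ t ] View.labels v (suc (combine r t)) ≡ nothing

  writable? : ∀ v r → Dec (Writable v r)
  writable? v r =
    (Maybe.≡-dec _≟_ _ _ ×-dec ¬? (any? λ t → MaybeAny.dec (_<? scale r) _)) ×-dec
    any? λ t → Maybe.≡-dec _≟_ _ _

  source : View (suc s) m → Fin rows → Fin T → Fin (suc s)
  source v r t with writable? v r
  ... | no  _            = suc (combine r t)
  ... | yes (_ , t₀ , _) with t ≟ t₀
  ...   | yes _ = zero
  ...   | no  _ = suc (combine r t)

  algorithm : (View s m → List (Fin s)) → StreamAlgorithm s m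
  algorithm output = record
    -- Nothing is evicted: each cell keeps its content or, if it is the chosen free cell, takes the
    -- arriving point.
    { update = λ v c → just (uncurry (source v) (remQuot T c))
    ; output = output
    }

  module _ (output : View s m → List (Fin s)) {n k} (I : Instance n m k)
           (0<scale : ∀ r → 0# < scale r) where

    open Instance I
    open IsGeneralMetric isMetric using (≈⇒0)

    next : Vector (Maybe (Fin n)) s → Fin n → Vector (Maybe (Fin n)) s
    next = step (algorithm output) I

    -- The two outcomes for one row, detached from the indexing of the whole memory. `kept` records
    -- why the point was refused, from which `represented-new` extracts a close point or a full row.
    data RowStep (mem : Vector (Maybe (Fin n)) s) (x : Fin n) (r : Fin rows) : Set where
      kept : ¬ Writable (view (algorithm output) I (just x ◂ mem)) r →
             (∀ t → next mem x (combine r t) ≡ mem (combine r t)) → RowStep mem x r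
      written : label x ≡ colour r →
             (∀ {t p} → mem (combine r t) ≡ just p → scale r ≤ d x p) →
             (t₀ : Fin T) → mem (combine r t₀) ≡ nothing →
             next mem x (combine r t₀) ≡ just x →
             (∀ {t} → t ≢ t₀ → next mem x (combine r t) ≡ mem (combine r t)) → RowStep mem x r

    rowStep : ∀ mem x r → RowStep mem x r
    -- The decision comes with its equation, so that `rewrite` can reduce `source` on this row.
    rowStep mem x r = classify (writable? v r) refl
      where
      cells = just x ◂ mem
      v = view (algorithm output) I cells
      next≡ : ∀ t → next mem x (combine r t) ≡ cells (source v r t)
      next≡ t = ≡.cong (cells ∘ uncurry (source v)) (remQuot-combine r t)
      empty : ∀ (y : Maybe (Fin n)) → Maybe.map label y ≡ nothing → y ≡ nothing
      empty nothing _ = refl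
      classify : ∀ w → writable? v r ≡ w → RowStep mem x r
      classify (no ¬w) eq = kept ¬w λ t → ≡.trans (next≡ t) (unchanged t)
        where
        unchanged : ∀ t → cells (source v r t) ≡ mem (combine r t)
        unchanged t rewrite eq = refl
      classify (yes ((same , far) , t₀ , free)) eq =
        written (Maybe.just-injective same) far′ t₀ (empty _ free)
          (≡.trans (next≡ t₀) changed) (λ t≢t₀ → ≡.trans (next≡ _) (unchanged t≢t₀))
        where
        far′ : ∀ {t p} → mem (combine r t) ≡ just p → scale r ≤ d x p
        far′ {t} {p} eq′ = ≮⇒≥ λ xp → far (t , ≡.subst
          (λ y → MaybeAny.Any (_< scale r) (Maybe.zipWith d (just x) y)) (≡.sym eq′) (just xp))
        changed : cells (source v r t₀) ≡ just x
        changed rewrite eq with t₀ ≟ t₀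
        ... | yes _    = refl
        ... | no t₀≢t₀ = contradiction refl t₀≢t₀
        unchanged : ∀ {t} → t ≢ t₀ → cells (source v r t) ≡ mem (combine r t)
        unchanged {t} t≢t₀ rewrite eq with t ≟ t₀
        ... | yes t≡t₀ = contradiction t≡t₀ t≢t₀
        ... | no  _    = refl

    private
      conflict : ∀ {y : Maybe (Fin n)} {p} → y ≡ nothing → ¬ (y ≡ just p)
      conflict refl ()

    -- Only an empty cell is ever written.
    persistent : ∀ mem x r t {p} → mem (combine r t) ≡ just p → next mem x (combine r t) ≡ just p
    persistent mem x r t eq with rowStep mem x r
    ... | kept _ same = ≡.trans (same t) eq
    ... | written _ _ t₀ free _ same =
      ≡.trans (same λ { refl → conflict free eq }) eq

    record Sound (mem : Vector (Maybe (Fin n)) s) : Set where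
      field
        coloured  : ∀ r {t p} → mem (combine r t) ≡ just p → label p ≡ colour r
        separated : ∀ r {t t′ p q} → t ≢ t′ → mem (combine r t) ≡ just p →
                    mem (combine r t′) ≡ just q → scale r ≤ d p q

    Represented : Vector (Maybe (Fin n)) s → Fin rows → Fin n → Set
    Represented mem r x = (∀ t → ∃[ p ] mem (combine r t) ≡ just p) ⊎
                          (∃[ t ] ∃[ p ] mem (combine r t) ≡ just p × d x p < scale r)

    -- A point is tested against its whole row before it is written; symmetry of the metric handles
    -- pairs in which it comes second.
    sound-next : ∀ mem x → Sound mem → Sound (next mem x)
    sound-next mem x sound = record { coloured = coloured′ ; separated = separated′ }
      where
      open Sound sound
      open IsGeneralMetric isMetric using () renaming (sym to d-sym)
      coloured′ : ∀ r {t p} → next mem x (combine r t) ≡ just p → label p ≡ colour r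
      coloured′ r {t} eq with rowStep mem x r
      ... | kept _ same = coloured r (≡.trans (≡.sym (same t)) eq)
      ... | written col _ t₀ _ new same with t ≟ t₀
      ...   | yes refl = ≡.subst (λ z → label z ≡ colour r)
                (Maybe.just-injective (≡.trans (≡.sym new) eq)) col
      ...   | no t≢t₀  = coloured r (≡.trans (≡.sym (same t≢t₀)) eq)
      separated′ : ∀ r {t t′ p q} → t ≢ t′ → next mem x (combine r t) ≡ just p →
                   next mem x (combine r t′) ≡ just q → scale r ≤ d p q
      separated′ r {t} {t′} t≢t′ eq eq′ with rowStep mem x r
      ... | kept _ same = separated r t≢t′ (≡.trans (≡.sym (same t)) eq) (≡.trans (≡.sym (same t′)) eq′)
      ... | written _ far t₀ _ new same with t ≟ t₀ | t′ ≟ t₀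
      ...   | yes refl | yes refl = contradiction refl t≢t′
      ...   | yes refl | no t′≢t₀ with refl ← ≡.trans (≡.sym new) eq =
                far (≡.trans (≡.sym (same t′≢t₀)) eq′)
      ...   | no t≢t₀  | yes refl with refl ← ≡.trans (≡.sym new) eq′ =
                ≤-respʳ (d-sym _ _) (far (≡.trans (≡.sym (same t≢t₀)) eq))
      ...   | no t≢t₀  | no t′≢t₀ =
                separated r t≢t′ (≡.trans (≡.sym (same t≢t₀)) eq) (≡.trans (≡.sym (same t′≢t₀)) eq′)

    -- An accepted point represents itself, at distance zero below the positive scale. A refused
    -- point of the right colour is close to a stored one or finds no free cell.
    represented-new : ∀ mem x r → label x ≡ colour r → Represented (next mem x) r x
    represented-new mem x r col with rowStep mem x r
    ... | written _ _ t₀ _ new _ = inj₂ (t₀ , x , new ,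
            ≤-respˡ (sym (≈⇒0 refl)) (proj₁ (0<scale r)) ,
            λ xx≈ → proj₂ (0<scale r) (trans (sym (≈⇒0 refl)) xx≈))
    ... | kept ¬w same with any? (λ t → MaybeAny.dec (_<? scale r) (Maybe.zipWith d (just x) (mem (combine r t))))
    ...   | yes (t , close) = inj₂ (t , near (mem (combine r t)) refl close)
      where
      near : ∀ y → mem (combine r t) ≡ y → MaybeAny.Any (_< scale r) (Maybe.zipWith d (just x) y) →
             ∃[ p ] next mem x (combine r t) ≡ just p × d x p < scale r
      near (just p) eq (just xp) = p , ≡.trans (same t) eq , xp
    ...   | no far = inj₁ λ t → occupied t (mem (combine r t)) refl
      where
      occupied : ∀ t y → mem (combine r t) ≡ y → ∃[ p ] next mem x (combine r t) ≡ just p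
      occupied t (just p) eq = p , ≡.trans (same t) eq
      occupied t nothing  eq = contradiction
        ((≡.cong just col , far) , t , ≡.cong (Maybe.map label) eq) ¬w

    represented-next : ∀ mem x r {y} → Represented mem r y → Represented (next mem x) r y
    represented-next mem x r (inj₁ full) = inj₁ λ t →
      let p , eq = full t in p , persistent mem x r t eq
    represented-next mem x r (inj₂ (t , p , eq , yp)) = inj₂ (t , p , persistent mem x r t eq , yp)

    sound-foldl : ∀ xs mem → Sound mem → Sound (foldl next mem xs)
    sound-foldl []       mem sound = sound
    sound-foldl (x ∷ xs) mem sound = sound-foldl xs (next mem x) (sound-next mem x sound)

    represented-foldl : ∀ xs mem r {y} → Represented mem r y → Represented (foldl next mem xs) r y
    represented-foldl []       mem r rep = rep
    represented-foldl (x ∷ xs) mem r rep =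
      represented-foldl xs (next mem x) r (represented-next mem x r rep)

    represented-∈ : ∀ xs mem r {y} → y List.∈ xs → label y ≡ colour r →
                    Represented (foldl next mem xs) r y
    represented-∈ (x ∷ xs) mem r (here refl)  col =
      represented-foldl xs (next mem x) r (represented-new mem x r col)
    represented-∈ (x ∷ xs) mem r (there y∈xs) col = represented-∈ xs (next mem x) r y∈xs col

    finalMemory-sound : Sound (finalMemory (algorithm output) I)
    finalMemory-sound = sound-foldl (allFin n) (λ _ → nothing)
      record { coloured = λ _ () ; separated = λ _ _ () }

    finalMemory-represents : ∀ r x → label x ≡ colour r →
                             Represented (finalMemory (algorithm output) I) r x
    finalMemory-represents r x = represented-∈ (allFin n) (λ _ → nothing) r (∈-allFin x)

    -- Replaces the final memory by an arbitrary one with the invariants, so that later arguments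
    -- never unfold the fold over the stream.
    result-induction : (P : Subset n → Set) →
      (∀ memory → Sound memory → (∀ r x → label x ≡ colour r → Represented memory r x) →
        P (⋃ (List.map (maybe′ ⁅_⁆ ⊥ ∘ memory) (output (view (algorithm output) I memory))))) →
      P (result (algorithm output) I)
    result-induction P holds =
      holds (finalMemory (algorithm output) I) finalMemory-sound finalMemory-represents

-- Exhaustive search over the memory.

module BestSubset (ℝ : Reals) {s m : ℕ} (k : Vec ℕ m) where

  open Reals ℝ hiding (zero) renaming (refl to ≈-refl)
  open Diversification ℝ
  open RealProperties ℝ
  private
    module ≤⁺ = TotalOrder ≤⁺-totalOrder

  labelled? : (v : View s m) (i : Fin m) (a : Fin s) → Dec (View.labels v a ≡ just i)
  labelled? v i a = Maybe.≡-dec _≟_ (View.labels v a) (just i)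

  cellsOf : View s m → Fin m → Subset s
  cellsOf v i = comprehension (labelled? v i)

  -- Phrased by labels and distances alone, so that the algorithm can decide it from the view. A
  -- missing distance fails `Any`, so an empty cell cannot occur next to another member of `L`.
  Valid : View s m → Carrier ⁺ → Subset s → Set
  Valid v Q L =
    (∀ a b → a ∈ L → b ∈ L → a ≢ b → MaybeAny.Any (λ x → Q ≤⁺ [ x ]) (View.distances v a b)) ×
    (∀ i → lookup k i ℕ.≤ ∣ L ∩ cellsOf v i ∣)

  valid? : ∀ v Q L → Dec (Valid v Q L)
  valid? v Q L =
    (all? λ a → all? λ b → a ∈? L →-dec b ∈? L →-dec ¬? (a ≟ b) →-dec
       MaybeAny.dec (λ x → AddSupremum.≤⁺-dec _≤_ _≤?_ Q [ x ]) _) ×-dec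
    (all? λ i → lookup k i ℕ.≤? ∣ L ∩ cellsOf v i ∣)

  best : List (Carrier ⁺) → View s m → List (Fin s)
  best []       v = []
  best (Q ∷ Qs) v with anySubset? (valid? v Q)
  ... | yes (L , _) = elements L
  ... | no  _       = best Qs v

  -- The targets are tried in decreasing order, so the first success is at least as large as any
  -- attainable target.
  best-valid : ∀ {Q Qs v L} → AllPairs (flip _≤⁺_) Qs → Q List.∈ Qs → Valid v Q L →
               ∃[ Q′ ] ∃[ L′ ] Q ≤⁺ Q′ × Valid v Q′ L′ × best Qs v ≡ elements L′
  best-valid {Q} {Q₀ ∷ Qs} {v} {L} (≤Q₀ ∷ decreasing) Q∈ valid with anySubset? (valid? v Q₀)
  ... | yes (L′ , valid′) = Q₀ , L′ , below Q∈ , valid′ , refl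
    where
    below : Q List.∈ (Q₀ ∷ Qs) → Q ≤⁺ Q₀
    below (here refl) = ≤⁺.refl
    below (there Q∈)  = All.lookup ≤Q₀ Q∈
  ... | no ¬valid with Q∈
  ...   | here refl = contradiction (L , valid) ¬valid
  ...   | there Q∈  = best-valid decreasing Q∈ valid

  module _ {n} (I : Instance n m k) where

    open Instance I
    open IsGeneralMetric isMetric using (≈⇒0)

    -- With `div-≤⁺` this characterises `div` as a greatest lower bound; the default value `⊤⁺` lies
    -- above every `Q`.
    div-≥⁺ : ∀ {Q S} → (∀ {u v} → u ∈ S → v ∈ S → u ≢ v → Q ≤⁺ [ d u v ]) → Q ≤⁺ div S
    div-≥⁺ {Q} {S} far = Extrema.v≤min⁺ ≤⁺-totalOrder (Q AddSupremum.≤⊤⁺)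
      (All.map⁺ (All.tabulate λ uv∈ →
        let _ , u∈S , v∈S , u≢v = ∈-filter⁻ (λ (u , v) → u ∈? S ×-dec v ∈? S ×-dec ¬? (u ≟ v))
                                    {xs = cartesianProduct (allFin n) (allFin n)} uv∈
        in far u∈S v∈S u≢v))

    div-≤⁺ : ∀ {S u v} → u ∈ S → v ∈ S → u ≢ v → div S ≤⁺ [ d u v ]
    div-≤⁺ {S} {u} {v} u∈S v∈S u≢v = All.lookup (Extrema.min≤xs ≤⁺-totalOrder ⊤⁺ _)
      (∈-map⁺ ([_] ∘ uncurry d)
        (∈-filter⁺ (λ (u , v) → u ∈? S ×-dec v ∈? S ×-dec ¬? (u ≟ v))
          (∈-cartesianProduct⁺ (∈-allFin u) (∈-allFin v)) (u∈S , v∈S , u≢v)))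

    -- Excludes one point being counted twice: its distance to itself cannot reach a target above
    -- zero.
    0≱ : ∀ {Q u} → ¬ (Q ≤⁺ [ 0# ]) → ¬ (Q ≤⁺ [ d u u ])
    0≱ Q≰0 Q≤ = Q≰0 (≤⁺.trans Q≤ AddSupremum.[ ≤-reflexive (≈⇒0 refl) ])

    module _ (A : StreamAlgorithm s m) (mem : Fin s → Maybe (Fin n)) {Q : Carrier ⁺}
             (Q≰0 : ¬ (Q ≤⁺ [ 0# ])) where

      selected : Subset s → Subset n
      selected L = ⋃ (List.map (maybe′ ⁅_⁆ ⊥ ∘ mem) (elements L))

      ∈-selected⁺ : ∀ {L a u} → a ∈ L → mem a ≡ just u → u ∈ selected L
      ∈-selected⁺ {u = u} a∈L eq = ∈-⋃⁺ (∈-map⁺ (maybe′ ⁅_⁆ ⊥ ∘ mem) (∈-elements⁺ a∈L))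
        (≡.subst (λ y → u ∈ maybe′ ⁅_⁆ ⊥ y) (≡.sym eq) (x∈⁅x⁆ u))

      ∈-selected⁻ : ∀ {L u} → u ∈ selected L → ∃[ a ] a ∈ L × mem a ≡ just u
      ∈-selected⁻ {L} {u} u∈ with ∈-⋃⁻ (List.map (maybe′ ⁅_⁆ ⊥ ∘ mem) (elements L)) u∈
      ... | _ , p∈ , u∈p with ∈-map⁻ (maybe′ ⁅_⁆ ⊥ ∘ mem) p∈
      ... | a , a∈ , refl = a , ∈-elements⁻ a∈ , holds (mem a) u∈p
        where
        holds : ∀ y → u ∈ maybe′ ⁅_⁆ ⊥ y → y ≡ just u
        holds nothing  u∈ = contradiction u∈ ∉⊥
        holds (just x) u∈ = ≡.cong just (≡.sym (x∈⁅y⁆⇒x≡y x u∈))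

      valid-far : ∀ {L a b u v} → Valid (view A I mem) Q L → a ∈ L → b ∈ L → a ≢ b →
                  mem a ≡ just u → mem b ≡ just v → Q ≤⁺ [ d u v ]
      valid-far {a = a} {b} (far , _) a∈L b∈L a≢b eq eq′ = MaybeAny.drop-just
        (≡.subst₂ (λ y z → MaybeAny.Any (λ x → Q ≤⁺ [ x ]) (Maybe.zipWith d y z)) eq eq′
          (far a b a∈L b∈L a≢b))

      selected-diverse : ∀ {L} → Valid (view A I mem) Q L → Q ≤⁺ div (selected L)
      selected-diverse valid = div-≥⁺ λ u∈ v∈ u≢v →
        let a , a∈L , eq  = ∈-selected⁻ u∈
            b , b∈L , eq′ = ∈-selected⁻ v∈
        in valid-far valid a∈L b∈L
             (λ a≡b → u≢v (Maybe.just-injective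
               (≡.trans (≡.sym eq) (≡.trans (≡.cong mem a≡b) eq′)))) eq eq′

      -- A point may be stored in several rows, but distinct cells of a valid `L` hold distinct
      -- points, so no count is lost in passing from cells to points.
      selected-fair : ∀ {L} → Valid (view A I mem) Q L → ∀ i →
                      lookup k i ℕ.≤ ∣ selected L ∩ group i ∣
      selected-fair {L} valid i = ℕ.≤-trans (proj₂ valid i)
        (∣p∣≤∣q∣-injective (L ∩ cellsOf (view A I mem) i) (selected L ∩ group i) Holds total′ injective)
        where
        Holds : Fin s → Fin n → Set
        Holds a u = a ∈ L × mem a ≡ just u
        labelled : ∀ y → Maybe.map label y ≡ just i → ∃[ u ] y ≡ just u × label u ≡ i
        labelled (just u) eq = u , refl , Maybe.just-injective eq
        total′ : ∀ {a} → a ∈ L ∩ cellsOf (view A I mem) i → ∃[ u ] u ∈ selected L ∩ group i × Holds a u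
        total′ {a} a∈ =
          let a∈L , a∈i     = x∈p∩q⁻ L _ a∈
              u , eq , u∈i = labelled (mem a) (∈-comprehension⁻ (labelled? (view A I mem) i) a∈i)
          in u , x∈p∩q⁺ (∈-selected⁺ a∈L eq , ∈-comprehension⁺ (λ x → label x ≟ i) u∈i) , a∈L , eq
        injective : ∀ {a b u} → Holds a u → Holds b u → a ≡ b
        injective {a} {b} (a∈L , eq) (b∈L , eq′) with a ≟ b
        ... | yes a≡b = a≡b
        ... | no  a≢b = contradiction (valid-far valid a∈L b∈L a≢b eq eq′) (0≱ Q≰0)

      module _ (S : Subset n) (feasible : Feasible S)
        (f : Fin n → Fin n) (cellOf : Fin n → Maybe (Fin s))
        (label-f : ∀ {x} → x ∈ S → label (f x) ≡ label x)
        (stored : ∀ {x} → x ∈ S → ∃[ a ] cellOf x ≡ just a × mem a ≡ just (f x))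
        (far : ∀ {x y} → x ∈ S → y ∈ S → x ≢ y → Q ≤⁺ [ d (f x) (f y) ])
        where

        Stores : Fin s → Fin n → Set
        Stores a x = x ∈ S × cellOf x ≡ just a

        stores? : ∀ a → Dec (∃ (Stores a))
        stores? a = any? λ x → x ∈? S ×-dec Maybe.≡-dec _≟_ (cellOf x) (just a)

        image : Subset s
        image = comprehension stores?

        stores⇒mem : ∀ {a x} → Stores a x → mem a ≡ just (f x)
        stores⇒mem (x∈S , eq) with stored x∈S
        ... | b , eq′ , eq″ with refl ← ≡.trans (≡.sym eq) eq′ = eq″

        -- Completeness of the search. A target above zero forces `f` to be injective on `S`, so the
        -- cells storing the images meet the quotas that `S` meets.
        image-valid : Valid (view A I mem) Q image
        image-valid = far′ , λ i → ≡.subst (ℕ._≤ ∣ image ∩ cellsOf (view A I mem) i ∣) (feasible i)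
            (∣p∣≤∣q∣-injective (S ∩ group i) (image ∩ cellsOf (view A I mem) i)
              (flip Stores) (total′ i) injective)
          where
          far′ : ∀ a b → a ∈ image → b ∈ image → a ≢ b →
                 MaybeAny.Any (λ x → Q ≤⁺ [ x ]) (Maybe.zipWith d (mem a) (mem b))
          far′ a b a∈ b∈ a≢b with ∈-comprehension⁻ stores? a∈ | ∈-comprehension⁻ stores? b∈
          ... | x , xa | y , yb rewrite stores⇒mem xa | stores⇒mem yb =
            just (far (proj₁ xa) (proj₁ yb)
              λ { refl → a≢b (Maybe.just-injective (≡.trans (≡.sym (proj₂ xa)) (proj₂ yb))) })
          total′ : ∀ i {x} → x ∈ S ∩ group i → ∃[ a ] a ∈ image ∩ cellsOf (view A I mem) i × Stores a x
          total′ i {x} x∈ =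
            let x∈S , x∈i = x∈p∩q⁻ S (group i) x∈
                a , cell≡ , mem≡ = stored x∈S
            in a , x∈p∩q⁺ (∈-comprehension⁺ stores? (x , x∈S , cell≡) ,
                 ∈-comprehension⁺ (labelled? (view A I mem) i)
                   (≡.trans (≡.cong (Maybe.map label) mem≡) (≡.cong just
                     (≡.trans (label-f x∈S) (∈-comprehension⁻ (λ y → label y ≟ i) x∈i))))) ,
               x∈S , cell≡
          injective : ∀ {x y a} → Stores a x → Stores a y → x ≡ y
          injective {x} {y} xa ya with x ≟ y
          ... | yes x≡y = x≡y
          ... | no  x≢y = contradiction
            (≡.subst (λ z → Q ≤⁺ [ d (f x) z ])
              (Maybe.just-injective (≡.trans (≡.sym (stores⇒mem ya)) (stores⇒mem xa)))
              (far (proj₁ xa) (proj₁ ya) x≢y))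
            (0≱ Q≰0)

-- Geometric guesses and the approximation guarantee.

-- Row (j , i) holds points of group i for the guess lo β ^ j / κ.  The factor
-- κ = 1 + 4 τ pays for moving both endpoints of a pair by 2 τ times the guess.
module Scheme (ℝ : Reals) {m : ℕ} (k : Vec ℕ m) (M N : ℕ) (τ β lo : Reals.Carrier ℝ) where

  open Reals ℝ hiding (zero) renaming (refl to ≈-refl)
  open Diversification ℝ
  open RealProperties ℝ
  private
    module ≤⁺ = TotalOrder ≤⁺-totalOrder

  -- At least one guess exists, so that row index `zero` is available when `S` has no two points.
  J : ℕ
  J = suc N

  κ : Carrier
  κ = 1# + ι 4 * τ

  guess : ℕ → Carrier
  guess j = lo * β ^ j / κ

  separation : ℕ → Carrier
  separation j = τ * guess j + τ * guess j

  scale : Fin (J ℕ.* m) → Carrier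
  scale r = separation (toℕ (proj₁ (remQuot {J} m r)))

  colour : Fin (J ℕ.* m) → Fin m
  colour r = proj₂ (remQuot {J} m r)

  -- At least `∣ S ∣ * M` for every feasible `S`, so a row without free cells is full in the sense
  -- of the selection argument.
  T : ℕ
  T = Vec.sum k ℕ.* M

  open RowAlgorithm ℝ T scale colour
  open BestSubset ℝ {s} k

  -- ⊤⁺ accounts for optimal sets with at most one element, whose diversity is ∞.
  targets : List (Carrier ⁺)
  targets = ⊤⁺ ∷ applyDownFrom ([_] ∘ guess) J

  module _ (1≤M : 1 ℕ.≤ M) (0<τ : 0# < τ) (0<lo : 0# < lo) (1≤β : 1# ≤ β) where

    0<κ : 0# < κ
    0<κ = 1≤⇒0< (x≤x+y 1# (*-nonNegative (0≤ι 4) (proj₁ 0<τ)))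

    0<guess : ∀ j → 0# < guess j
    0<guess j = *-positive (*-positive 0<lo (1≤⇒0< (1≤^ 1≤β j))) (0<x⁻¹ 0<κ)

    0<separation : ∀ j → 0# < separation j
    0<separation j = ≤-trans (proj₁ p) (x≤x+y _ (proj₁ p)) ,
      λ 0≈ → proj₂ p (antisym (proj₁ p) (≤-respʳ (sym 0≈) (x≤x+y _ (proj₁ p))))
      where p = *-positive 0<τ (0<guess j)

    β^-mono : ∀ {i j} → i ℕ.≤ j → β ^ i ≤ β ^ j
    β^-mono {j = j} z≤n = 1≤^ 1≤β j
    β^-mono (s≤s i≤j)   = *-monoʳ-≤ (≤-trans 0≤1 1≤β) (β^-mono i≤j)

    guess-mono : ∀ {i j} → i ℕ.≤ j → guess i ≤ guess j
    guess-mono i≤j = *-monoˡ-≤ (0≤x⁻¹ 0<κ) (*-monoʳ-≤ (proj₁ 0<lo) (β^-mono i≤j))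

    targets-decreasing : AllPairs (flip _≤⁺_) targets
    targets-decreasing =
      All.applyDownFrom⁺₂ _ J (λ _ → _ AddSupremum.≤⊤⁺) ∷
      AllPairs.applyDownFrom⁺₁ _ J (λ j<i _ → AddSupremum.[ guess-mono (ℕ.<⇒≤ j<i) ])

    κ*guess≈ : ∀ j → κ * guess j ≈ lo * β ^ j
    κ*guess≈ j = trans (*-comm κ (guess j)) (x/z*z≈x _ 0<κ)

    -- The powers of `β` cut the range into buckets; the search descends from the top one.
    locate : ∀ {ℓ} N → lo ≤ ℓ → ℓ ≤ lo * β ^ suc N →
             ∃[ j ] lo * β ^ toℕ {suc N} j ≤ ℓ × ℓ ≤ lo * β ^ suc (toℕ j)
    locate zero lo≤ℓ ℓ≤ = zero , ≤-respˡ (sym (*-identityʳ lo)) lo≤ℓ , ℓ≤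
    locate {ℓ} (suc N) lo≤ℓ ℓ≤ with lo * β ^ suc N ≤? ℓ
    ... | yes ≤ℓ = fromℕ (suc N) ,
            ≡.subst (λ i → lo * β ^ i ≤ ℓ × ℓ ≤ lo * β ^ suc i) (≡.sym (toℕ-fromℕ (suc N))) (≤ℓ , ℓ≤)
    ... | no  ≰ℓ with locate N lo≤ℓ (≰⇒≥ ≰ℓ)
    ...   | j , ≤ℓ≤ = inject₁ j ,
            ≡.subst (λ i → lo * β ^ i ≤ ℓ × ℓ ≤ lo * β ^ suc i) (≡.sym (toℕ-inject₁ j)) ≤ℓ≤

    0<scale : ∀ r → 0# < scale r
    0<scale r = 0<separation (toℕ (proj₁ (remQuot {J} m r)))

    module Approximation {n} (I : Instance n m k)
      (covers : ∀ {R} → 0# < R → Selection.Covers ℝ I M R (τ * R))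
      (memory : Fin s → Maybe (Fin n))
      (sound : Sound (best targets) I 0<scale memory)
      (represents : ∀ r x → Instance.label I x ≡ colour r → Represented (best targets) I 0<scale memory r x)
      where

      open Instance I
      open IsGeneralMetric isMetric using (≈⇒0)
      open Selection ℝ I using (Separated; selection)
      open Sound sound

      module _ (S : Subset n) (feasible : Feasible S) (j : Fin J) where

        ∣S∣≤k : ∣ S ∣ ℕ.≤ Vec.sum k
        ∣S∣≤k = ∣p∣≤sum k group S
          (λ {x} _ → label x , ∈-comprehension⁺ (λ y → label y ≟ label x) refl)
          (λ i → ℕ.≤-reflexive (feasible i))

        R = guess (toℕ j)

        row : Fin m → Fin (J ℕ.* m)
        row = combine j

        scale-row : ∀ i → scale (row i) ≡ separation (toℕ j)
        scale-row i = ≡.cong (separation ∘ toℕ ∘ proj₁) (remQuot-combine j i)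

        colour-row : ∀ i → colour (row i) ≡ i
        colour-row i = ≡.cong proj₂ (remQuot-combine j i)

        Holds : Fin m → Fin n → Fin T → Set
        Holds i p t = memory (combine (row i) t) ≡ just p

        holds? : ∀ i p → Dec (∃ (Holds i p))
        holds? i p = any? λ t → Maybe.≡-dec _≟_ (memory (combine (row i) t)) (just p)

        G : Fin m → Subset n
        G i = comprehension (holds? i)

        G-separated : ∀ i → Separated (separation (toℕ j)) (G i)
        G-separated i {x} {y} x∈G y∈G x≢y
          with ∈-comprehension⁻ (holds? i) x∈G | ∈-comprehension⁻ (holds? i) y∈G
        ... | t , eq | t′ , eq′ = ≡.subst (_≤ d x y) (scale-row i) (separated (row i)
          (λ { refl → x≢y (Maybe.just-injective (≡.trans (≡.sym eq) eq′)) }) eq eq′)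

        -- Two cells of a row are at least its positive scale apart, so they cannot hold the same
        -- point.
        holds-injective : ∀ {i p t t′} → Holds i p t → Holds i p t′ → t ≡ t′
        holds-injective {i} {p} {t} {t′} eq eq′ with t ≟ t′
        ... | yes t≡t′ = t≡t′
        ... | no  t≢t′ = contradiction
          (≤-respʳ (≈⇒0 refl) (separated (row i) t≢t′ eq eq′)) (<⇒≱ (0<scale (row i)))

        -- If the row has no free cell, its `T` distinct points contradict the assumption that the
        -- group is not full. Otherwise the invariant gives a close stored point.
        near : ∀ x → ¬ (∣ S ∣ ℕ.* M ℕ.≤ ∣ G (label x) ∣) →
               ∃[ y ] y ∈ G (label x) × d x y ≤ separation (toℕ j)
        near x ¬full
          with represents (row (label x)) x (≡.sym (colour-row (label x)))
        ... | inj₂ (t , p , eq , xp) = p , ∈-comprehension⁺ (holds? (label x)) (t , eq) ,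
                ≡.subst (d x p ≤_) (scale-row (label x)) (proj₁ xp)
        ... | inj₁ full = contradiction (ℕ.≤-trans (ℕ.*-monoˡ-≤ M ∣S∣≤k) T≤∣G∣) ¬full
          where
          T≤∣G∣ : T ℕ.≤ ∣ G (label x) ∣
          T≤∣G∣ = ≡.subst (ℕ._≤ ∣ G (label x) ∣) (∣⊤∣≡n T)
            (∣p∣≤∣q∣-injective ⊤ (G (label x)) (λ t p → Holds (label x) p t)
              (λ {t} _ → let p , eq = full t in
                 p , ∈-comprehension⁺ (holds? (label x)) (t , eq) , eq)
              holds-injective)

        -- Dividing by `κ = 1 + 4 τ` in `guess` is made for this: `κ R` is `R` plus four moves of
        -- `τ R`.
        spread⇒ : Separated (lo * β ^ toℕ j) S → Separated (R + ((τ * R + τ * R) + (τ * R + τ * R))) S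
        spread⇒ spread x∈S y∈S x≢y = ≤-respˡ (begin-equality
          lo * β ^ toℕ j ≈⟨ κ*guess≈ (toℕ j) ⟨
          κ * R          ≈⟨ solve 2 (λ t a → (con 1 :+ num 4 :* t) :* a :=
                              a :+ ((t :* a :+ t :* a) :+ (t :* a :+ t :* a))) ≈-refl τ R ⟩
          R + ((τ * R + τ * R) + (τ * R + τ * R)) ∎) (spread x∈S y∈S x≢y)

        module _ (f : Fin n → Fin n) (f∈G : ∀ {x} → x ∈ S → f x ∈ G (label x)) where

          located : ∀ {x} → x ∈ S → ∃ (Holds (label x) (f x))
          located {x} x∈S = ∈-comprehension⁻ (holds? (label x)) (f∈G x∈S)

          -- Deciding `x ∈? S` fixes one cell per point, whatever membership proof is at hand later.
          cellOf : Fin n → Maybe (Fin s)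
          cellOf x with x ∈? S
          ... | yes x∈S = just (combine (row (label x)) (proj₁ (located x∈S)))
          ... | no  _   = nothing

          stored : ∀ {x} → x ∈ S → ∃[ a ] cellOf x ≡ just a × memory a ≡ just (f x)
          stored {x} x∈S with x ∈? S
          ... | yes x∈S = combine (row (label x)) (proj₁ (located x∈S)) , refl , proj₂ (located x∈S)
          ... | no  x∉S = contradiction x∈S x∉S

          label-f : ∀ {x} → x ∈ S → label (f x) ≡ label x
          label-f {x} x∈S =
            ≡.trans (coloured (row (label x)) (proj₂ (located x∈S))) (colour-row (label x))

          image-exists : ∀ {Q} → ¬ (Q ≤⁺ [ 0# ]) →
            (∀ {x y} → x ∈ S → y ∈ S → x ≢ y → Q ≤⁺ [ d (f x) (f y) ]) →
            ∃ (Valid (view (algorithm (best targets)) I memory) Q)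
          image-exists {Q} Q≰0 far =
            image I (algorithm (best targets)) memory {Q} Q≰0 S feasible f cellOf label-f stored far ,
            image-valid I (algorithm (best targets)) memory {Q} Q≰0 S feasible f cellOf label-f stored far

        -- `Q` is `[ R ]` in the finite case and `⊤⁺` when `S` has no two points, where `bound` is
        -- vacuous.
        valid-exists : ∀ {Q} → ¬ (Q ≤⁺ [ 0# ]) → Separated (lo * β ^ toℕ j) S →
          (∀ {x y p q} → x ∈ S → y ∈ S → x ≢ y → R ≤ d p q → Q ≤⁺ [ d p q ]) →
          ∃ (Valid (view (algorithm (best targets)) I memory) Q)
        valid-exists {Q} Q≰0 spread bound =
          let f , f∈G , f-far = selection S G 1≤M (covers (0<guess (toℕ j))) G-separated near (spread⇒ spread)
          in image-exists f f∈G {Q} Q≰0 (λ x∈S y∈S x≢y → bound x∈S y∈S x≢y (f-far x∈S y∈S x≢y))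

      Approximates : Carrier → Carrier → Carrier ⁺ → List (Fin s) → Set
      Approximates α ε ℓ cells = ApproximatesFairly α ε ℓ (⋃ (List.map (maybe′ ⁅_⁆ ⊥ ∘ memory) cells))

      approximates : ∀ {α ε hi ℓ*} → 0# ≤ ε → 0# < α → κ * β ≤ α → hi ≤ lo * β ^ J →
        DistancesWithin lo hi → IsOptimalDiversity ℓ* → Approximates α ε ℓ* (best targets (view (algorithm (best targets)) I memory))
      approximates {α} {ε} {hi} {ℓ*} 0≤ε 0<α κβ≤α hi≤ within ((S , feasible , S≈ℓ*) , _) =
        conclude (attained ℓ* S≈ℓ* (distinctPairs S) refl)
        where
        pair? = λ ((u , v) : Fin n × Fin n) → u ∈? S ×-dec v ∈? S ×-dec ¬? (u ≟ v)

        Attained : Carrier ⁺ → Set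
        Attained ℓ = ∃[ Q ] Q List.∈ targets × ¬ (Q ≤⁺ [ 0# ]) × ℓ /⁺ α ≤⁺ Q ×
                     ∃ (Valid (view (algorithm (best targets)) I memory) Q)

        attained : ∀ ℓ → div S ≈⁺ ℓ → ∀ ps → distinctPairs S ≡ ps → Attained ℓ
        attained ℓ _ [] none = ⊤⁺ , here refl , (λ ()) , (_ AddSupremum.≤⊤⁺) ,
          valid-exists S feasible zero (λ ())
            (λ x∈S y∈S x≢y → contradiction (x∈S , y∈S , x≢y) no-pair)
            (λ x∈S y∈S x≢y → contradiction (x∈S , y∈S , x≢y) no-pair)
          where
          no-pair : ∀ {x y} → ¬ (x ∈ S × y ∈ S × x ≢ y)
          no-pair {x} {y} xy with () ← ≡.subst ((x , y) List.∈_) none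
            (∈-filter⁺ pair? (∈-cartesianProduct⁺ (∈-allFin x) (∈-allFin y)) xy)
        attained ℓ div≈ℓ ((u , v) ∷ _) some
          with _ , u∈S , v∈S , u≢v ← ∈-filter⁻ pair? {xs = cartesianProduct (allFin n) (allFin n)}
                 (≡.subst ((u , v) List.∈_) (≡.sym some) (here refl)) = finite ℓ ℓ≤div div≤ℓ
          where
          ℓ≤div = ≤⁺.reflexive (≤⁺.Eq.sym div≈ℓ)
          div≤ℓ = ≤⁺.reflexive div≈ℓ
          finite : ∀ ℓ → ℓ ≤⁺ div S → div S ≤⁺ ℓ → Attained ℓ
          -- The pair `u`, `v` bounds the diversity by a real number.
          finite ⊤⁺ ℓ≤ _ with () ← ≤⁺.trans ℓ≤ (div-≤⁺ I u∈S v∈S u≢v)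
          -- As a minimum of actual distances, `ℓ` lies between `lo` and `hi` and falls into a
          -- bucket.
          finite [ ℓ ] ℓ≤ ≤ℓ with locate _ lo≤ℓ ℓ≤lo*β^J
            where
            lo≤ℓ : lo ≤ ℓ
            lo≤ℓ with AddSupremum.[ p ] ← ≤⁺.trans (div-≥⁺ I {S = S} λ {x} {y} _ _ x≢y →
                        AddSupremum.[ proj₁ (within x y x≢y) ]) ≤ℓ = p
            ℓ≤lo*β^J : ℓ ≤ lo * β ^ J
            ℓ≤lo*β^J with AddSupremum.[ p ] ← ≤⁺.trans ℓ≤ (div-≤⁺ I u∈S v∈S u≢v) =
              ≤-trans p (≤-trans (proj₂ (within u v u≢v)) hi≤)
          ... | j , below , above =
            [ guess (toℕ j) ] , there (∈-applyDownFrom⁺ _ (toℕ<n j)) ,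
            (λ { AddSupremum.[ p ] → <⇒≱ (0<guess (toℕ j)) p }) ,
            AddSupremum.[ x≤y*z⇒x/z≤y 0<α ℓ≤guess*α ] ,
            valid-exists S feasible j (λ { AddSupremum.[ p ] → <⇒≱ (0<guess (toℕ j)) p })
              (λ {x} {y} x∈S y∈S x≢y → ≤-trans below (far x∈S y∈S x≢y))
              (λ _ _ _ → AddSupremum.[_])
            where
            far : ∀ {x y} → x ∈ S → y ∈ S → x ≢ y → ℓ ≤ d x y
            far x∈S y∈S x≢y with AddSupremum.[ p ] ← ≤⁺.trans ℓ≤ (div-≤⁺ I x∈S y∈S x≢y) = p
            -- The bucket loses a factor `β` and the guess a factor `κ`; `α` absorbs both.
            ℓ≤guess*α : ℓ ≤ guess (toℕ j) * α
            ℓ≤guess*α = begin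
              ℓ                        ≤⟨ above ⟩
              lo * (β * β ^ toℕ j)     ≈⟨ solve 3 (λ a b c → a :* (b :* c) := a :* c :* b) ≈-refl lo β (β ^ toℕ j) ⟩
              lo * β ^ toℕ j * β       ≈⟨ *-congʳ (κ*guess≈ (toℕ j)) ⟨
              κ * guess (toℕ j) * β    ≈⟨ solve 3 (λ a b c → a :* b :* c := b :* (a :* c)) ≈-refl κ (guess (toℕ j)) β ⟩
              guess (toℕ j) * (κ * β)  ≤⟨ *-monoʳ-≤ (proj₁ (0<guess (toℕ j))) κβ≤α ⟩
              guess (toℕ j) * α        ∎

        1-ε≤1 : 1# - ε ≤ 1#
        1-ε≤1 = begin
          1# - ε     ≤⟨ x≤x+y _ 0≤ε ⟩
          1# - ε + ε ≈⟨ +-assoc 1# (- ε) ε ⟩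
          1# + (- ε + ε) ≈⟨ +-congˡ (-‿inverseˡ ε) ⟩
          1# + 0#    ≈⟨ +-identityʳ 1# ⟩
          1#         ∎

        conclude : Attained ℓ* → Approximates α ε ℓ* (best targets (view (algorithm (best targets)) I memory))
        conclude (Q , Q∈ , Q≰0 , ℓ/α≤Q , L , valid) =
          let Q′ , L′ , Q≤Q′ , valid′ , best≡ = best-valid {L = L} targets-decreasing Q∈ valid
              Q′≰0 = Q≰0 ∘ ≤⁺.trans Q≤Q′
          in ≡.subst (Approximates α ε ℓ*) (≡.sym best≡)
            ( ≤⁺.trans ℓ/α≤Q (≤⁺.trans Q≤Q′ (selected-diverse I (algorithm (best targets)) memory {Q′} Q′≰0 valid′))
            -- The selected set meets the whole quota, and the factor `1 - ε` only lowers it.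
            , λ i → begin
                (1# - ε) * ι (lookup k i)                   ≤⟨ *-monoˡ-≤ (0≤ι (lookup k i)) 1-ε≤1 ⟩
                1# * ι (lookup k i)                         ≈⟨ *-identityˡ (ι (lookup k i)) ⟩
                ι (lookup k i)                              ≤⟨ ι-mono-≤ (selected-fair I (algorithm (best targets)) memory {Q′} Q′≰0 valid′ i) ⟩
                ι ∣ selected I (algorithm (best targets)) memory {Q′} Q′≰0 L′ ∩ group i ∣ ∎)

    scheme-approximates : ∀ {n} (I : Instance n m k) →
      (∀ {R} → 0# < R → Selection.Covers ℝ I M R (τ * R)) →
      ∀ {α ε hi ℓ*} → 0# ≤ ε → 0# < α → κ * β ≤ α → hi ≤ lo * β ^ J →
      Instance.DistancesWithin I lo hi → Instance.IsOptimalDiversity I ℓ* →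
      Instance.ApproximatesFairly I α ε ℓ* (result (algorithm (best targets)) I)
    scheme-approximates I covers {α} {ε} {hi} {ℓ*} 0≤ε 0<α κβ≤α hi≤ within optimal =
      result-induction (best targets) I 0<scale (Instance.ApproximatesFairly I α ε ℓ*)
        λ memory sound represents → Approximation.approximates I covers memory sound represents
          {α} {ε} {hi} {ℓ*} 0≤ε 0<α κβ≤α hi≤ within optimal

    -- The algorithm is fixed before the instance. `P` is the assumption on the metric that yields
    -- the covers.
    streaming : ∀ {n α ε hi bound} (P : Instance n m k → Set) →
      (∀ I → P I → ∀ {R} → 0# < R → Selection.Covers ℝ I M R (τ * R)) →
      0# ≤ ε → 0# < α → κ * β ≤ α → hi ≤ lo * β ^ suc N →
      ι (suc N ℕ.* m ℕ.* (Vec.sum k ℕ.* M)) ≤ bound →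
      ∃[ s ] ι s ≤ bound × (Σ[ A ∈ StreamAlgorithm s m ]
        ∀ I → P I → Instance.DistancesWithin I lo hi → ∀ ℓ* → Instance.IsOptimalDiversity I ℓ* →
        Instance.ApproximatesFairly I α ε ℓ* (result A I))
    streaming P covers 0≤ε 0<α κβ≤α hi≤ small = s , small , algorithm (best targets) ,
      λ I p within ℓ* optimal → scheme-approximates I (covers I p) 0≤ε 0<α κβ≤α hi≤ within optimal

-- Choice of parameters, space bound and approximation factors.

module Parameters (ℝ : Reals) (c n : ℕ) (2≤n : 2 ℕ.≤ n) (ε lo hi : Reals.Carrier ℝ)
  (0<ε : Reals._<_ ℝ (Reals.0# ℝ) ε) (ε<1 : Reals._<_ ℝ ε (Reals.1# ℝ))
  (0<lo : Reals._<_ ℝ (Reals.0# ℝ) lo)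
  (ratio : Reals._≤_ ℝ (Reals._/_ ℝ hi lo) (Reals.ι ℝ (n ℕ.^ c)))
  where

  open Reals ℝ hiding (zero) renaming (refl to ≈-refl)
  open Diversification ℝ
  open Instance using (DistancesWithin; IsOptimalDiversity; ApproximatesFairly; Doubling)
  open RealProperties ℝ
  open SemiringExp semiring using (^-assocʳ)

  -- The common unit `ε / 8`: the ratio `β` is `1 + ε / 4`, and `e` itself serves as `τ` in the
  -- doubling case.
  e β : Carrier
  e = ε / ι 8
  β = 1# + ι 2 * e

  ε≈ : ε ≈ ι 8 * e
  ε≈ = trans (sym (x/z*z≈x ε (0<ι 7))) (*-comm e (ι 8))

  0<e : 0# < e
  0<e = *-positive 0<ε (0<x⁻¹ (0<ι 7))

  ι2*e≤ε : ι 2 * e ≤ ε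
  ι2*e≤ε = ≤-respʳ (sym ε≈) (*-monoˡ-≤ (proj₁ 0<e) (ι-mono-≤ {2} {8} (s≤s (s≤s z≤n))))

  1≤β : 1# ≤ β
  1≤β = x≤x+y 1# (*-nonNegative (0≤ι 2) (proj₁ 0<e))

  1≤ε⁻¹ : 1# ≤ ε ⁻¹
  1≤ε⁻¹ = ≤-respʳ (*-identityˡ (ε ⁻¹)) (x*z≤y⇒x≤y/z 0<ε (≤-respˡ (sym (*-identityˡ ε)) (proj₁ ε<1)))

  -- `4 * E` guesses double the distance, so `4 * E * (suc c * L)` of them span the ratio `n ^ c`.
  -- Using `suc c` keeps this number positive for `c = 0`, and the predecessor matches `J = suc N`.
  E L N : ℕ
  E = proj₁ (ceiling 1≤ε⁻¹)
  L = ⌈log₂ n ⌉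
  N = ℕ.pred (4 ℕ.* E ℕ.* (suc c ℕ.* L))

  ε⁻¹≤E : ε ⁻¹ ≤ ι E
  ε⁻¹≤E = proj₁ (proj₂ (ceiling 1≤ε⁻¹))

  E≤2ε⁻¹ : ι E ≤ ι 2 * ε ⁻¹
  E≤2ε⁻¹ = proj₂ (proj₂ (ceiling 1≤ε⁻¹))

  1+N≡ : suc N ≡ 4 ℕ.* E ℕ.* (suc c ℕ.* L)
  1+N≡ = ℕ.suc-pred _ {{ℕ.>-nonZero (ℕ.*-mono-≤ {1} (ℕ.*-mono-≤ {1} {4} (s≤s z≤n) 1≤E)
                                                     (ℕ.*-mono-≤ {1} {suc c} (s≤s z≤n) 1≤L))}}
    where
    1≤E : 1 ℕ.≤ E
    1≤E = ι-cancel-≤ (≤-trans (≤-reflexive (+-identityʳ 1#)) (≤-trans 1≤ε⁻¹ ε⁻¹≤E))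
    1≤L : 1 ℕ.≤ L
    1≤L = ⌈log₂⌉-mono-≤ 2≤n

  -- Bernoulli: (1 + ε / 4) ^ (4 E) ≥ 1 + E ε ≥ 2.
  ι2≤β^[4E] : ι 2 ≤ β ^ (4 ℕ.* E)
  ι2≤β^[4E] = begin
    ι 2                               ≈⟨ +-congˡ (+-identityʳ 1#) ⟩
    1# + 1#                           ≈⟨ +-congˡ (trans (*-comm (ε ⁻¹) ε) (x*x⁻¹≈1 0<ε)) ⟨
    1# + ε ⁻¹ * ε                     ≤⟨ +-monoʳ-≤ 1# (*-monoˡ-≤ (proj₁ 0<ε) ε⁻¹≤E) ⟩
    1# + ι E * ε                      ≈⟨ +-congˡ (*-congˡ ε≈) ⟩
    1# + ι E * (ι 8 * e)              ≈⟨ solve 2 (λ a b → con 1 :+ a :* (num 8 :* b)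
                                           := con 1 :+ num 4 :* a :* (num 2 :* b)) ≈-refl (ι E) e ⟩
    1# + ι 4 * ι E * (ι 2 * e)        ≈⟨ +-congˡ (*-congʳ (ι-* 4 E)) ⟨
    1# + ι (4 ℕ.* E) * (ι 2 * e)      ≤⟨ bernoulli (*-nonNegative (0≤ι 2) (proj₁ 0<e)) (4 ℕ.* E) ⟩
    β ^ (4 ℕ.* E)                     ∎

  n^c≤ : n ℕ.^ c ℕ.≤ 2 ℕ.^ (suc c ℕ.* L)
  n^c≤ = ℕ.≤-trans (ℕ.^-monoˡ-≤ c (n≤2^⌈log₂n⌉ n)) (ℕ.≤-trans
    (ℕ.≤-reflexive (≡.trans (ℕ.^-*-assoc 2 L c) (≡.cong (2 ℕ.^_) (ℕ.*-comm L c))))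
    (ℕ.^-monoʳ-≤ 2 (ℕ.m≤n+m (c ℕ.* L) L)))

  hi≤ : hi ≤ lo * β ^ suc N
  hi≤ = begin
    hi                                          ≤⟨ x/z≤y⇒x≤y*z 0<lo ratio ⟩
    ι (n ℕ.^ c) * lo                            ≈⟨ *-comm _ lo ⟩
    lo * ι (n ℕ.^ c)                            ≤⟨ *-monoʳ-≤ (proj₁ 0<lo) (begin
      ι (n ℕ.^ c)                               ≤⟨ ι-mono-≤ n^c≤ ⟩
      ι (2 ℕ.^ (suc c ℕ.* L))                   ≤⟨ ι^≤^ 2 ι2≤β^[4E] (suc c ℕ.* L) ⟩
      (β ^ (4 ℕ.* E)) ^ (suc c ℕ.* L)           ≈⟨ ^-assocʳ β (4 ℕ.* E) (suc c ℕ.* L) ⟩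
      β ^ (4 ℕ.* E ℕ.* (suc c ℕ.* L))           ≡⟨ ≡.cong (β ^_) 1+N≡ ⟨
      β ^ suc N                                 ∎) ⟩
    lo * β ^ suc N                              ∎

  -- The constant 16 is 4 from the doubling of `β` times 2 for each of the roundings `E` and `M`;
  -- `X` is the real quantity behind `M`.
  space : ∀ m K M {X} → ι M ≤ ι 2 * X →
    ι (suc N ℕ.* m ℕ.* (K ℕ.* M)) ≤ ι (16 ℕ.* suc c) * (X * ι K * ι m * ε ⁻¹ * ι L)
  space m K M {X} M≤2X = begin
    ι (suc N ℕ.* m ℕ.* (K ℕ.* M))
      ≡⟨ ≡.cong (λ J → ι (J ℕ.* m ℕ.* (K ℕ.* M))) 1+N≡ ⟩
    ι (4 ℕ.* E ℕ.* (suc c ℕ.* L) ℕ.* m ℕ.* (K ℕ.* M))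
      ≈⟨ ι-* (4 ℕ.* E ℕ.* (suc c ℕ.* L) ℕ.* m) (K ℕ.* M) ⟩
    ι (4 ℕ.* E ℕ.* (suc c ℕ.* L) ℕ.* m) * ι (K ℕ.* M)
      ≈⟨ *-cong (trans (ι-* (4 ℕ.* E ℕ.* (suc c ℕ.* L)) m) (*-congʳ
           (trans (ι-* (4 ℕ.* E) (suc c ℕ.* L)) (*-cong (ι-* 4 E) (ι-* (suc c) L))))) (ι-* K M) ⟩
    ι 4 * ι E * (ι (suc c) * ι L) * ι m * (ι K * ι M)
      ≈⟨ solve 7 (λ f a b l m k M → f :* a :* (b :* l) :* m :* (k :* M)
           := (f :* b :* l :* m :* k) :* (a :* M)) ≈-refl (ι 4) (ι E) (ι (suc c)) (ι L) (ι m) (ι K) (ι M) ⟩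
    ι 4 * ι (suc c) * ι L * ι m * ι K * (ι E * ι M)
      ≤⟨ *-monoʳ-≤ (*-nonNegative (*-nonNegative (*-nonNegative (*-nonNegative
           (0≤ι 4) (0≤ι (suc c))) (0≤ι L)) (0≤ι m)) (0≤ι K))
         (*-mono-≤ (*-nonNegative (0≤ι 2) (0≤x⁻¹ 0<ε)) (0≤ι M) E≤2ε⁻¹ M≤2X) ⟩
    ι 4 * ι (suc c) * ι L * ι m * ι K * (ι 2 * ε ⁻¹ * (ι 2 * X))
      ≈⟨ solve 8 (λ f t b l m k i x → f :* b :* l :* m :* k :* (t :* i :* (t :* x))
           := f :* (t :* t) :* b :* (x :* k :* m :* i :* l)) ≈-refl
           (ι 4) (ι 2) (ι (suc c)) (ι L) (ι m) (ι K) (ε ⁻¹) X ⟩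
    ι 4 * (ι 2 * ι 2) * ι (suc c) * (X * ι K * ι m * ε ⁻¹ * ι L)
      ≈⟨ *-congʳ (*-congʳ (trans (ι-* 4 4) (*-congˡ (ι-* 2 2)))) ⟨
    ι 16 * ι (suc c) * (X * ι K * ι m * ε ⁻¹ * ι L)
      ≈⟨ *-congʳ (ι-* 16 (suc c)) ⟨
    ι (16 ℕ.* suc c) * (X * ι K * ι m * ε ⁻¹ * ι L) ∎

  0<1+ε : 0# < 1# + ε
  0<1+ε = 1≤⇒0< (x≤x+y 1# (proj₁ 0<ε))

  0<30*[1+ε] : 0# < ι 30 * (1# + ε)
  0<30*[1+ε] = *-positive (0<ι 29) 0<1+ε

  -- At `τ = 1` the factor `κ` is 5, and `β` is at most `1 + ε`.
  general-factor : (1# + ι 4 * 1#) * β ≤ ι 30 * (1# + ε)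
  general-factor = *-mono-≤ (0≤ι 30) (≤-trans 0≤1 1≤β)
    (≤-respˡ (+-congˡ (sym (*-identityʳ (ι 4)))) (ι-mono-≤ {5} {30} (ℕ.m≤m+n 5 25)))
    (+-monoʳ-≤ 1# ι2*e≤ε)

  -- The product is `1 + 6 e + 8 e²`, and `8 e = ε ≤ 2` turns the square term into at most `2 e`.
  doubling-factor : (1# + ι 4 * e) * β ≤ 1# + ε
  doubling-factor = begin
    (1# + ι 4 * e) * (1# + ι 2 * e)
      ≈⟨ solve 1 (λ x → (con 1 :+ num 4 :* x) :* (con 1 :+ num 2 :* x)
           := con 1 :+ num 6 :* x :+ num 8 :* x :* x) ≈-refl e ⟩
    1# + ι 6 * e + ι 8 * e * e
      ≤⟨ +-monoʳ-≤ _ (*-mono-≤ (0≤ι 2) (proj₁ 0<e) ι8*e≤ι2 ≤-refl) ⟩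
    1# + ι 6 * e + ι 2 * e
      ≈⟨ solve 1 (λ x → con 1 :+ num 6 :* x :+ num 2 :* x := con 1 :+ num 8 :* x) ≈-refl e ⟩
    1# + ι 8 * e
      ≈⟨ +-congˡ ε≈ ⟨
    1# + ε ∎
    where
    ι8*e≤ι2 : ι 8 * e ≤ ι 2
    ι8*e≤ι2 = ≤-respˡ ε≈ (≤-trans (proj₁ ε<1) (1≤ι 1))

  -- A ball covers itself, which is why `M = τ = 1` works in any metric.
  general-covers : ∀ {m k} (I : Instance n m k) {R} → 0# < R →
    Selection.Covers ℝ I 1 R (1# * R)
  general-covers I {R} _ p = p ∷ [] , s≤s z≤n , λ q pq → here
    (≤-respʳ (sym (*-identityˡ R)) (proj₁ pq) , λ pq≈ → proj₂ pq (trans pq≈ (*-identityˡ R)))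

  1≤8/ε : 1# ≤ ι 8 / ε
  1≤8/ε = x*z≤y⇒x≤y/z 0<ε (≤-respˡ (sym (*-identityˡ ε)) (≤-trans (proj₁ ε<1) (1≤ι 7)))

  -- The ratio of the radii `R` and `e R` is `8 / ε`; since `2 e = ε / 4 ≤ 1`, the scales are far
  -- enough apart for `Doubling`.
  doubling-covers : ∀ {m k dim M} (I : Instance n m k) → Doubling I dim → (ι 8 / ε) ^ dim ≤ ι M →
    ∀ {R} → 0# < R → Selection.Covers ℝ I M R (e * R)
  doubling-covers {dim = dim} {M} I doubling ≤M {R} 0<R p =
    let centres , few , covered = doubling p R (e * R) 0<eR ι2*eR≤R
    in centres , ι-cancel-≤ (≤-trans few (≤-trans (^-monoˡ-≤ 0≤R/eR R/eR≤ dim) ≤M)) , covered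
    where
    0<eR = *-positive 0<e 0<R
    ι2*eR≤R : ι 2 * (e * R) ≤ R
    ι2*eR≤R = begin
      ι 2 * (e * R) ≈⟨ *-assoc (ι 2) e R ⟨
      ι 2 * e * R   ≤⟨ *-monoˡ-≤ (proj₁ 0<R) (≤-trans ι2*e≤ε (proj₁ ε<1)) ⟩
      1# * R        ≈⟨ *-identityˡ R ⟩
      R             ∎
    0≤R/eR : 0# ≤ R / (e * R)
    0≤R/eR = *-nonNegative (proj₁ 0<R) (0≤x⁻¹ 0<eR)
    R/eR≤ : R / (e * R) ≤ ι 8 / ε
    R/eR≤ = x≤y*z⇒x/z≤y 0<eR (≤-reflexive (begin-equality
      R                        ≈⟨ *-identityˡ R ⟨
      1# * R                   ≈⟨ *-congʳ (x*x⁻¹≈1 0<ε) ⟨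
      ε * ε ⁻¹ * R             ≈⟨ *-congʳ (*-congʳ ε≈) ⟩
      ι 8 * e * ε ⁻¹ * R       ≈⟨ solve 4 (λ a b c d → a :* b :* c :* d := a :* c :* (b :* d)) ≈-refl (ι 8) e (ε ⁻¹) R ⟩
      ι 8 / ε * (e * R)        ∎))

  general : ∀ {m} (k : Vec ℕ m) →
    ∃[ s ] ι s ≤ ι (16 ℕ.* suc c) * (ε ⁻¹ * ι (Vec.sum k) * ι m * ι L) ×
      (Σ[ A ∈ StreamAlgorithm s m ] ∀ (I : Instance n m k) → DistancesWithin I lo hi →
        ∀ ℓ* → IsOptimalDiversity I ℓ* → ApproximatesFairly I (ι 30 * (1# + ε)) ε ℓ* (result A I))
  general {m} k =
    let s , small , A , correct = Scheme.streaming ℝ k 1 N 1# β lo (s≤s z≤n) 0<1 0<lo 1≤β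
          (λ _ → Unit.⊤) (λ I _ → general-covers I) (proj₁ 0<ε) 0<30*[1+ε] general-factor hi≤
          (≤-respʳ (*-congˡ (solve 4 (λ i k m l → con 1 :* k :* m :* i :* l := i :* k :* m :* l)
                    ≈-refl (ε ⁻¹) (ι (Vec.sum k)) (ι m) (ι L)))
            (space m (Vec.sum k) 1 (≤-respʳ (sym (*-identityʳ (ι 2))) (ι-mono-≤ {1} {2} (s≤s z≤n)))))
    in s , small , A , λ I → correct I Unit.tt

  doubling : ∀ {m} (k : Vec ℕ m) dim →
    ∃[ s ] ι s ≤ ι (16 ℕ.* suc c) * ((ι 8 / ε) ^ dim * ι (Vec.sum k) * ι m * ε ⁻¹ * ι L) ×
      (Σ[ A ∈ StreamAlgorithm s m ] ∀ (I : Instance n m k) → Doubling I dim → DistancesWithin I lo hi →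
        ∀ ℓ* → IsOptimalDiversity I ℓ* → ApproximatesFairly I (1# + ε) ε ℓ* (result A I))
  doubling {m} k dim =
    -- `M` rounds up the covering number `(8 / ε) ^ dim`, which is at least one.
    let 1≤X = 1≤^ 1≤8/ε dim
        M , X≤M , M≤2X = ceiling 1≤X
    in Scheme.streaming ℝ k M N e β lo
         (ι-cancel-≤ {1} (≤-trans (≤-reflexive (+-identityʳ 1#)) (≤-trans 1≤X X≤M))) 0<e 0<lo 1≤β
         (λ I → Doubling I dim) (λ I doubles → doubling-covers {dim = dim} I doubles X≤M)
         (proj₁ 0<ε) 0<1+ε doubling-factor hi≤ (space m (Vec.sum k) M M≤2X)

-- The two guarantees, with a constant depending on `c` alone.

corollary1 : (ℝ : Reals) →
    let open Reals ℝ
        open Diversification ℝ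
        open Instance
    in
    -- the ratio of the distance bounds is at most n ^ c
    (c : ℕ) →
    (∃[ C ] ∀ (n m : ℕ) (k : Vec ℕ m) (ε lo hi : Carrier) →
       2 ℕ.≤ n → 0# < ε → ε < 1# → 0# < lo → hi / lo ≤ ι (n ℕ.^ c) →
       ∃[ s ] ι s ≤ ι C * (ε ⁻¹ * ι (Vec.sum k) * ι m * ι ⌈log₂ n ⌉) ×
         (Σ[ A ∈ StreamAlgorithm s m ]
           ∀ (I : Instance n m k) → DistancesWithin I lo hi →
           ∀ ℓ* → IsOptimalDiversity I ℓ* →
           ApproximatesFairly I (ι 30 * (1# + ε)) ε ℓ* (result A I)))
    ×
    (∃[ C ] ∀ (n m : ℕ) (k : Vec ℕ m) (ε lo hi : Carrier) (dim : ℕ) →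
       2 ℕ.≤ n → 0# < ε → ε < 1# → 0# < lo → hi / lo ≤ ι (n ℕ.^ c) →
       ∃[ s ] ι s ≤ ι C * ((ι 8 / ε) ^ dim * ι (Vec.sum k) * ι m * ε ⁻¹ * ι ⌈log₂ n ⌉) ×
         (Σ[ A ∈ StreamAlgorithm s m ]
           ∀ (I : Instance n m k) → Euclidean I → IsDoublingDimension I dim →
           DistancesWithin I lo hi →
           ∀ ℓ* → IsOptimalDiversity I ℓ* →
           ApproximatesFairly I (1# + ε) ε ℓ* (result A I)))
corollary1 ℝ c =
  (16 ℕ.* suc c , λ n m k ε lo hi 2≤n 0<ε ε<1 0<lo ratio →
    Parameters.general ℝ c n 2≤n ε lo hi 0<ε ε<1 0<lo ratio k) ,
  (16 ℕ.* suc c , λ n m k ε lo hi dim 2≤n 0<ε ε<1 0<lo ratio →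
    let s , small , A , correct = Parameters.doubling ℝ c n 2≤n ε lo hi 0<ε ε<1 0<lo ratio k dim
    in s , small , A , λ I _ isDimension → correct I (proj₁ isDimension))
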